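{- For every integer $k\ge2$ and every $0\le\varepsilon<1$ there exist a family $X=X_{\delta,\Delta}$ of Euclidean $k$-means instances (indexed by $\delta,\Delta>0$ with $\Delta/\delta$ sufficiently large) and a valid $\varepsilon$-noisy adversary for $k$-means++ on these instances such that $$\lim_{\Delta/\delta\to\infty}\frac{\mathbf{E}_\varepsilon[\varphi(X,C)]}{\mathbf{E}_0[\varphi(X,C)]}\ \ge\ 1+\frac{\mathcal{H}_k-1}{\mathcal{H}_k}\,\varepsilon\ \ge\ 1+\frac{\varepsilon}{3}.$$ Here $\mathcal{H}_k=\sum_{m=1}^k 1/m$, $\mathbf{E}_\varepsilon$ denotes expectation when the $k$ centers $C$ are produced by $\varepsilon$-noisy $k$-means++ with this adversary, and $\mathbf{E}_0$ denotes expectation when $C$ is produced by exact $k$-means++. Consequently, a multiplicative loss of $1+\Omega(\varepsilon)$ with respect to exact $k$-means++ is unavoidable.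
   Context: For finite $X\subset\mathbb{R}^d$ and a nonempty finite set $C\subset\mathbb{R}^d$, $\varphi(X,C)=\sum_{x\in X}\min_{c\in C}\|x-c\|^2$ and $\varphi(x,C):=\varphi(\{x\},C)$. Exact $k$-means++ samples the first center uniformly from $X$ and then, given the set $C_j$ of the first $j$ centers ($1\le j<k$), samples the next center $x\in X$ with probability $p_{C_j}(x)=\varphi(x,C_j)/\varphi(X,C_j)$ and sets $C_{j+1}=C_j\cup\{x\}$; the output is $C=C_k$. $\varepsilon$-noisy $k$-means++ is the same procedure, except that a valid ($\varepsilon$-noisy) adversary, who may adapt to the history, replaces each sampling distribution by a probability distribution $q$ on $X$ that is pointwise within a factor in $[1-\varepsilon,1+\varepsilon]$ of the exact one: in the first round $q(x)\in[(1-\varepsilon)/|X|,(1+\varepsilon)/|X|]$, and in later rounds $(1-\varepsilon)p_{C_j}(x)\le q(x)\le(1+\varepsilon)p_{C_j}(x)$, for all $x\in X$. In the family, each $X_{\delta,\Delta}$ consists of $k$ clusters of equal size $m\geq 2$; distinct points in the same cluster are at distance $\delta$ and points in different clusters are at distance $\Delta$. -}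

module Defs where

open import Algebra.Bundles using (CommutativeRing)
import Algebra.Construct.NaturalChoice.Min as Min
import Algebra.Properties.Semiring.Mult as Mult
import Algebra.Properties.Semiring.Sum as Sum
open import Data.Fin.Base using (Fin; toℕ; quotient)
open import Data.List.NonEmpty as List⁺ using (List⁺; [_]; _∷⁺_)
open import Data.Nat.Base as ℕ using (ℕ; zero; suc)
open import Data.Product using (Σ-syntax; ∃; _×_)
open import Data.Vec.Functional using (Vector)
open import Data.Vec.Functional.Relation.Binary.Pointwise using (Pointwise)
open import Function.Definitions using (Injective)
open import Level using (0ℓ)
open import Relation.Binary.Bundles using (DecTotalOrder)
import Relation.Binary.Properties.DecTotalOrder as OrderProperties
open import Relation.Binary.PropositionalEquality using (_≡_)
open import Relation.Binary.Structures using (IsDecTotalOrder)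
open import Relation.Nullary using (¬_)
open import Relation.Unary using (Pred)

-- The real numbers, given by the axioms that determine them up to
-- isomorphism: an ordered field in which every inhabited subset that is
-- bounded above has a least upper bound.  The order is decidable, as it is
-- in classical mathematics.
record CompleteOrderedField : Set₁ where
  infix  8 _⁻¹
  infix  4 _≤_
  field
    commutativeRing : CommutativeRing 0ℓ 0ℓ

  open CommutativeRing commutativeRing public

  field
    _≤_             : Carrier → Carrier → Set
    isDecTotalOrder : IsDecTotalOrder _≈_ _≤_
    +-monoʳ-≤       : ∀ x {y z} → y ≤ z → x + y ≤ x + z
    *-nonNegative   : ∀ {x y} → 0# ≤ x → 0# ≤ y → 0# ≤ x * y

    0≉1        : ¬ (0# ≈ 1#)
    -- Total, but nothing is assumed about the value at zero.
    _⁻¹        : Carrier → Carrier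
    ⁻¹-cong    : ∀ {x y} → x ≈ y → x ⁻¹ ≈ y ⁻¹
    *-inverseʳ : ∀ {x} → ¬ (x ≈ 0#) → x * x ⁻¹ ≈ 1#

  UpperBound : Pred Carrier 0ℓ → Pred Carrier 0ℓ
  UpperBound P u = ∀ x → P x → x ≤ u

  field
    supremum : ∀ (P : Pred Carrier 0ℓ) → ∃ P → ∃ (UpperBound P) →
               Σ[ s ∈ Carrier ] UpperBound P s × (∀ u → UpperBound P u → s ≤ u)

  decTotalOrder : DecTotalOrder 0ℓ 0ℓ 0ℓ
  decTotalOrder = record { isDecTotalOrder = isDecTotalOrder }

module KMeans (ℜ : CompleteOrderedField) where

  open CompleteOrderedField ℜ public renaming (Carrier to ℝ)
  open OrderProperties decTotalOrder public using (_<_)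
  open Min (DecTotalOrder.totalOrder decTotalOrder) public using (_⊓_)
  open Sum semiring public using (sum)
  open Mult semiring using () renaming (_×_ to _·_)

  infixl 7 _/_

  _/_ : ℝ → ℝ → ℝ
  x / y = x * y ⁻¹

  fromℕ : ℕ → ℝ
  fromℕ n = n · 1#

  𝓗 : ℕ → ℝ
  𝓗 k = sum {k} λ i → 1# / fromℕ (suc (toℕ i))

  Point : ℕ → Set
  Point d = Vector ℝ d

  Points : ℕ → ℕ → Set
  Points d n = Vector (Point d) n

  ‖_-_‖² : ∀ {d} → Point d → Point d → ℝ
  ‖ x - y ‖² = sum λ i → (x i - y i) * (x i - y i)

  -- The distance of x and y is r, the nonnegative square root of ‖ x - y ‖².
  Distance : ∀ {d} → Point d → Point d → ℝ → Set
  Distance x y r = 0# ≤ r × r * r ≈ ‖ x - y ‖²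

  -- Makes an indexed family of points a set of n points.
  Distinct : ∀ {d n} → Points d n → Set
  Distinct X = Injective _≡_ (Pointwise _≈_) X

  -- Point i belongs to cluster quotient m i, so each of the k clusters has m
  -- points.
  EquidistantClusters : ∀ {d} k m → ℝ → ℝ → Points d (k ℕ.* m) → Set
  EquidistantClusters k m δ Δ X =
    (∀ i j → ¬ (i ≡ j) → quotient {k} m i ≡ quotient {k} m j → Distance (X i) (X j) δ) ×
    (∀ i j → ¬ (quotient {k} m i ≡ quotient {k} m j) → Distance (X i) (X j) Δ)

  pointCost : ∀ {d} → Point d → List⁺ (Point d) → ℝ
  pointCost x C = List⁺.foldr₁ _⊓_ (List⁺.map (λ c → ‖ x - c ‖²) C)

  φ : ∀ {d n} → Points d n → List⁺ (Point d) → ℝ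
  φ X C = sum λ i → pointCost (X i) C

  -- The indices of the centers chosen so far, the most recent one first.
  History : ℕ → Set
  History n = List⁺ (Fin n)

  centers : ∀ {d n} → Points d n → History n → List⁺ (Point d)
  centers X h = List⁺.map X h

  -- The sampling distributions of a seeding procedure: that of the first
  -- round, and those of the later rounds as a function of the history.
  record Sampler (n : ℕ) : Set where
    field
      first : Vector ℝ n
      next  : History n → Vector ℝ n

  -- The weights in next are meaningful only if φ X (centers X h) is nonzero,
  -- which holds if the points of X are distinct and outnumber those of h.
  exact : ∀ {d n} → Points d n → Sampler n
  exact {n = n} X = record
    { first = λ _ → 1# / fromℕ n
    ; next  = λ h x → pointCost (X x) (centers X h) / φ X (centers X h)
    }

  IsDistribution : ∀ {n} → Vector ℝ n → Set
  IsDistribution q = (∀ x → 0# ≤ q x) × sum q ≈ 1#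

  Noisy : ∀ {n} → ℝ → Vector ℝ n → Vector ℝ n → Set
  Noisy ε p q = ∀ x → (1# - ε) * p x ≤ q x × q x ≤ (1# + ε) * p x

  -- A is a valid ε-noisy adversary for k-means++ with k centers on X.
  record Valid {d n} (ε : ℝ) (k : ℕ) (X : Points d n) (A : Sampler n) : Set where
    private
      module P = Sampler (exact X)
      module Q = Sampler A
    field
      first-distribution : IsDistribution Q.first
      first-noisy        : Noisy ε P.first Q.first
      next-distribution  : ∀ h → List⁺.length h ℕ.< k → IsDistribution (Q.next h)
      next-noisy         : ∀ h → List⁺.length h ℕ.< k → Noisy ε (P.next h) (Q.next h)

  -- The expected final cost, given history h, when r more centers are sampled.
  expectedFrom : ∀ {d n} → Points d n → Sampler n → (r : ℕ) → History n → ℝ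
  expectedFrom X S zero    h = φ X (centers X h)
  expectedFrom X S (suc r) h =
    sum λ x → Sampler.next S h x * expectedFrom X S r (x ∷⁺ h)

  -- The expectation of φ(X,C) when C consists of k ≥ 1 centers sampled by S.
  𝔼 : ∀ {d n} → ℕ → Points d n → Sampler n → ℝ
  𝔼 k X S = sum λ x → Sampler.first S x * expectedFrom X S (ℕ.pred k) [ x ]

  -- f δ Δ tends to L as Δ / δ tends to infinity, with δ and Δ positive.
  Limit : (ℝ → ℝ → ℝ) → ℝ → Set
  Limit f L = ∀ η → 0# < η → Σ[ M ∈ ℝ ] (∀ δ Δ → 0# < δ → 0# < Δ → M ≤ Δ / δ →
              (- η) < (f δ Δ - L) × (f δ Δ - L) < η)

-- Let the k clusters be pairs of points, a = δ², b = Δ² and z = a / b, and let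
-- the adversary multiply the probability of hitting a covered cluster by
-- c = 1 + ε (c = 1 is exact k-means++).  As long as no cluster has been hit
-- twice and u clusters are uncovered, a miss has probability about
-- c (k - u) a / (2 u b) and leaves one more cluster uncovered at the end, at cost
-- 2b; two misses contribute only O(z a).  Summing over u = 1, …, k - 1 and adding
-- the cost k a of a perfect run gives
--   E[φ] = a (k + c (k 𝓗 k - k)) + O(z a),
-- and dividing the values at c = 1 + ε and c = 1 gives the limit.
module Submission where

open import Defs
import Algebra.Construct.NaturalChoice.Min as Min
import Algebra.Properties.AbelianGroup as AbelianGroupProperties
import Algebra.Properties.CommutativeMonoid.Sum as CommutativeMonoidSum
import Algebra.Properties.Ring as RingProperties
import Algebra.Properties.Semiring.Mult.TCOptimised as Mult
import Algebra.Properties.Semiring.Sum as SemiringSum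
import Algebra.Solver.Ring as RingSolver
open import Algebra.Solver.Ring.AlmostCommutativeRing
  using (fromCommutativeRing; _-Raw-AlmostCommutative⟶_)
open import Data.Bool.Base using (if_then_else_)
open import Data.Fin.Base as Fin using (Fin; zero; suc; combine; quotient; remainder; remQuot;
  toℕ)
import Data.Fin.Properties as Fin
open import Data.Integer.Base as ℤ using (ℤ; +_; -[1+_]; _⊖_)
import Data.Integer.Properties as ℤ
open import Data.List.Base using ([]; _∷_)
open import Data.List.Membership.Propositional using (_∈_; find; lose)
open import Data.List.NonEmpty.Base as List⁺ using (toList; [_]; _∷_; _∷⁺_)
open import Data.List.Relation.Unary.Any as Any using (Any; here; there)
open import Data.Maybe.Base using (Maybe; nothing; just)
open import Data.Nat.Base as ℕ using (ℕ; zero; suc)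
import Data.Nat.Properties as ℕ
open import Data.Product using (Σ-syntax; _×_; _,_; proj₁; proj₂)
open import Data.Sum.Base using (inj₁; inj₂)
open import Data.Vec.Functional using (Vector)
open import Function.Base using (_∘_)
open import Relation.Binary.Bundles using (DecTotalOrder)
open import Relation.Binary.PropositionalEquality as ≡ using (_≡_)
import Relation.Binary.Reasoning.Setoid as SetoidReasoning
open import Relation.Nullary using (¬_; Dec; yes; no; does; contradiction)
open import Relation.Nullary.Decidable using (decidable-stable)

-- After a miss a cluster may contain two centers, and the covered cost is then no longer determined
-- by the number of covered clusters. The recursion therefore runs at two precisions. For arbitrary
-- histories `lower` and `upper` locate the expected final cost up to `O(a)`, in terms of the excess
-- of uncovered clusters over remaining rounds. For histories without a miss `spread-lower` and
-- `spread-upper` locate it up to `O(z a)`; a miss has probability `O(z)`, so the rough bounds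
-- suffice right after it. Pairs keep the fine recursion exact, since a cluster with one center
-- costs exactly `a`. The adversary enters only through the probability of a miss, so `Boosts` lets
-- one proof serve both expectations. Validity asks for `a κ ≤ b`: the mass given to covered
-- clusters is taken from the uncovered ones, which may lose at most the fraction `ε` of theirs.

module Seeding (ℜ : CompleteOrderedField) where

  open KMeans ℜ hiding (zero)

  open Min (DecTotalOrder.totalOrder decTotalOrder) using (⊓-glb; x⊓y≤x; x⊓y≤y)
  open CommutativeMonoidSum +-commutativeMonoid using (∑-distrib-+)
  open SemiringSum semiring
    using (sum-cong-≋; *-distribˡ-sum; *-distribʳ-sum; sum-replicate-zero; sum-init-last)

  module ≈-Reasoning = SetoidReasoning setoid
  module O = DecTotalOrder decTotalOrder

  -- Integer coefficients for the ring solver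

  module IntegerCoefficients where
    open Mult semiring using (×-homo-+; ×1-homo-*; 1+×) renaming (_×_ to _×′_)
    open AbelianGroupProperties +-abelianGroup using (⁻¹-∙-comm)
    open RingProperties ring using (-‿involutive; -0#≈0#; -‿distribˡ-*; -‿distribʳ-*)
    open ≈-Reasoning

    -- The optimised multiple has no trailing zero: `con (+ 1)` denotes `1#` itself and `con (+ 2)`
    -- denotes `1# + 1#`, so solver equations match goals written in these forms. The numeral
    -- `fromℕ n` ends in `0#` and has to be spelled out instead.
    ⟦_⟧ : ℤ → ℝ
    ⟦ + n ⟧      = n ×′ 1#
    ⟦ -[1+ n ] ⟧ = - (suc n ×′ 1#)

    ⟦-⟧ : ∀ i → ⟦ ℤ.- i ⟧ ≈ - ⟦ i ⟧
    ⟦-⟧ (+ zero)   = sym -0#≈0#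
    ⟦-⟧ (+ suc n)  = refl
    ⟦-⟧ -[1+ n ]   = sym (-‿involutive _)

    1+x-1+y : ∀ x y → x - y ≈ (1# + x) - (1# + y)
    1+x-1+y x y = begin
      x - y                       ≈⟨ +-identityˡ _ ⟨
      0# + (x - y)                ≈⟨ +-congʳ (-‿inverseʳ 1#) ⟨
      (1# - 1#) + (x - y)         ≈⟨ +-assoc _ _ _ ⟩
      1# + (- 1# + (x - y))       ≈⟨ +-congˡ (+-assoc _ _ _) ⟨
      1# + ((- 1# + x) - y)       ≈⟨ +-congˡ (+-congʳ (+-comm _ _)) ⟩
      1# + ((x - 1#) - y)         ≈⟨ +-congˡ (+-assoc _ _ _) ⟩
      1# + (x + (- 1# - y))       ≈⟨ +-assoc _ _ _ ⟨
      (1# + x) + (- 1# - y)       ≈⟨ +-congˡ (⁻¹-∙-comm 1# y) ⟩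
      (1# + x) - (1# + y)         ∎

    ⟦⊖⟧ : ∀ m n → ⟦ m ⊖ n ⟧ ≈ m ×′ 1# - n ×′ 1#
    ⟦⊖⟧ zero    zero    = sym (-‿inverseʳ 0#)
    ⟦⊖⟧ zero    (suc n) = sym (+-identityˡ _)
    ⟦⊖⟧ (suc m) zero    = sym (trans (+-congˡ -0#≈0#) (+-identityʳ _))
    ⟦⊖⟧ (suc m) (suc n) = begin
      ⟦ suc m ⊖ suc n ⟧                   ≡⟨ ≡.cong ⟦_⟧ (ℤ.[1+m]⊖[1+n]≡m⊖n m n) ⟩
      ⟦ m ⊖ n ⟧                           ≈⟨ ⟦⊖⟧ m n ⟩
      m ×′ 1# - n ×′ 1#                   ≈⟨ 1+x-1+y _ _ ⟩
      (1# + m ×′ 1#) - (1# + n ×′ 1#)     ≈⟨ +-cong (1+× m 1#) (-‿cong (1+× n 1#)) ⟨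
      suc m ×′ 1# - suc n ×′ 1#           ∎

    ⟦+⟧ : ∀ i j → ⟦ i ℤ.+ j ⟧ ≈ ⟦ i ⟧ + ⟦ j ⟧
    ⟦+⟧ (+ m)    (+ n)    = ×-homo-+ 1# m n
    ⟦+⟧ (+ m)    -[1+ n ] = ⟦⊖⟧ m (suc n)
    ⟦+⟧ -[1+ m ] (+ n)    = trans (⟦⊖⟧ n (suc m)) (+-comm _ _)
    ⟦+⟧ -[1+ m ] -[1+ n ] = begin
      ⟦ -[1+ m ] ℤ.+ -[1+ n ] ⟧            ≡⟨ ≡.cong ⟦_⟧ (ℤ.neg-distrib-+ (+ suc m) (+ suc n)) ⟨
      ⟦ ℤ.- (+ (suc m ℕ.+ suc n)) ⟧        ≈⟨ ⟦-⟧ (+ (suc m ℕ.+ suc n)) ⟩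
      - ((suc m ℕ.+ suc n) ×′ 1#)          ≈⟨ -‿cong (×-homo-+ 1# (suc m) (suc n)) ⟩
      - (suc m ×′ 1# + suc n ×′ 1#)        ≈⟨ ⁻¹-∙-comm _ _ ⟨
      - (suc m ×′ 1#) - suc n ×′ 1#        ∎

    ⟦+*⟧ : ∀ m j → ⟦ + m ℤ.* j ⟧ ≈ m ×′ 1# * ⟦ j ⟧
    ⟦+*⟧ m (+ n)    = trans (reflexive (≡.cong ⟦_⟧ (≡.sym (ℤ.pos-* m n)))) (×1-homo-* m n)
    ⟦+*⟧ m -[1+ n ] = begin
      ⟦ + m ℤ.* ℤ.- (+ suc n) ⟧       ≡⟨ ≡.cong ⟦_⟧ (ℤ.neg-distribʳ-* (+ m) (+ suc n)) ⟨
      ⟦ ℤ.- (+ m ℤ.* + suc n) ⟧       ≈⟨ ⟦-⟧ (+ m ℤ.* + suc n) ⟩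
      - ⟦ + m ℤ.* + suc n ⟧           ≈⟨ -‿cong (⟦+*⟧ m (+ suc n)) ⟩
      - (m ×′ 1# * suc n ×′ 1#)       ≈⟨ -‿distribʳ-* _ _ ⟩
      m ×′ 1# * - (suc n ×′ 1#)       ∎

    ⟦*⟧ : ∀ i j → ⟦ i ℤ.* j ⟧ ≈ ⟦ i ⟧ * ⟦ j ⟧
    ⟦*⟧ (+ m)    j = ⟦+*⟧ m j
    ⟦*⟧ -[1+ m ] j = begin
      ⟦ ℤ.- (+ suc m) ℤ.* j ⟧         ≡⟨ ≡.cong ⟦_⟧ (ℤ.neg-distribˡ-* (+ suc m) j) ⟨
      ⟦ ℤ.- (+ suc m ℤ.* j) ⟧         ≈⟨ ⟦-⟧ (+ suc m ℤ.* j) ⟩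
      - ⟦ + suc m ℤ.* j ⟧             ≈⟨ -‿cong (⟦+*⟧ (suc m) j) ⟩
      - (suc m ×′ 1# * ⟦ j ⟧)         ≈⟨ -‿distribˡ-* _ _ ⟩
      - (suc m ×′ 1#) * ⟦ j ⟧         ∎

    homomorphism : ℤ.+-*-rawRing -Raw-AlmostCommutative⟶ fromCommutativeRing commutativeRing
    homomorphism = record
      { ⟦_⟧ = ⟦_⟧ ; +-homo = ⟦+⟧ ; *-homo = ⟦*⟧ ; -‿homo = ⟦-⟧ ; 0-homo = refl ; 1-homo = refl }

    _≟′_ : ∀ i j → Maybe (⟦ i ⟧ ≈ ⟦ j ⟧)
    i ≟′ j with i ℤ.≟ j
    ... | yes ≡.refl = just refl
    ... | no _       = nothing

  open IntegerCoefficients using (homomorphism; _≟′_)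
  open RingSolver ℤ.+-*-rawRing (fromCommutativeRing commutativeRing) homomorphism _≟′_
    using (solve; _:=_; _:+_; _:*_; _:-_; :-_; con)

  -- Ordered fields

  ≤-resp-≈ : ∀ {x y x′ y′} → x ≈ x′ → y ≈ y′ → x ≤ y → x′ ≤ y′
  ≤-resp-≈ x≈x′ y≈y′ x≤y = O.trans (O.reflexive (sym x≈x′)) (O.trans x≤y (O.reflexive y≈y′))

  0≤-resp-≈ : ∀ {x y} → x ≈ y → 0# ≤ x → 0# ≤ y
  0≤-resp-≈ = ≤-resp-≈ refl

  0≤y-x : ∀ {x y} → x ≤ y → 0# ≤ y - x
  0≤y-x {x} {y} x≤y =
    ≤-resp-≈ (solve 1 (λ x → :- x :+ x := con (+ 0)) refl x)
             (solve 2 (λ x y → :- x :+ y := y :- x) refl x y)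
             (+-monoʳ-≤ (- x) x≤y)

  -- Inequalities are proved by certificates: y - x equals, as a polynomial, an
  -- expression s whose nonnegativity is evident from its shape.  A hypothesis
  -- u ≈ v enters the certificate as a term (u - v) * m.
  ≤-by : ∀ {x y s} → 0# ≤ s → y - x ≈ s → x ≤ y
  ≤-by {x} {y} {s} 0≤s y-x≈s =
    ≤-resp-≈ (+-identityʳ x)
             (trans (+-congˡ (sym y-x≈s)) (solve 2 (λ x y → x :+ (y :- x) := y) refl x y))
             (+-monoʳ-≤ x 0≤s)

  +-mono-≤ : ∀ {x x′ y y′} → x ≤ x′ → y ≤ y′ → x + y ≤ x′ + y′
  +-mono-≤ {x} {x′} {y} {y′} x≤x′ y≤y′ = O.trans (+-monoʳ-≤ x y≤y′)
    (≤-resp-≈ (+-comm y′ x) (+-comm y′ x′) (+-monoʳ-≤ y′ x≤x′))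

  infixl 6 _⊕_
  infixl 7 _⊗_

  _⊕_ : ∀ {x y} → 0# ≤ x → 0# ≤ y → 0# ≤ x + y
  _⊕_ {x} {y} 0≤x 0≤y = O.trans 0≤x (≤-resp-≈ (+-identityʳ x) refl (+-monoʳ-≤ x 0≤y))

  _⊗_ : ∀ {x y} → 0# ≤ x → 0# ≤ y → 0# ≤ x * y
  _⊗_ = *-nonNegative

  ≈⇒0≤[x-y]*m : ∀ {x y} → x ≈ y → ∀ m → 0# ≤ (x - y) * m
  ≈⇒0≤[x-y]*m {x} {y} x≈y m = O.reflexive (sym (begin
    (x - y) * m ≈⟨ *-congʳ (+-congʳ x≈y) ⟩
    (y - y) * m ≈⟨ solve 2 (λ y m → (y :- y) :* m := con (+ 0)) refl y m ⟩
    0#          ∎))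
    where open ≈-Reasoning

  x-y≈0⇒x≈y : ∀ {x y} → x - y ≈ 0# → x ≈ y
  x-y≈0⇒x≈y {x} {y} x-y≈0 = begin
    x           ≈⟨ solve 2 (λ x y → x := (x :- y) :+ y) refl x y ⟩
    (x - y) + y ≈⟨ +-congʳ x-y≈0 ⟩
    0# + y      ≈⟨ +-identityˡ y ⟩
    y           ∎
    where open ≈-Reasoning

  0≤x² : ∀ x → 0# ≤ x * x
  0≤x² x with O.total 0# x
  ... | inj₁ 0≤x = 0≤x ⊗ 0≤x
  ... | inj₂ x≤0 = 0≤-resp-≈ (solve 1 (λ x → (con (+ 0) :- x) :* (con (+ 0) :- x) := x :* x) refl x)
                             (0≤y-x x≤0 ⊗ 0≤y-x x≤0)

  0≤1 : 0# ≤ 1#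
  0≤1 = 0≤-resp-≈ (*-identityˡ 1#) (0≤x² 1#)

  0<1 : 0# < 1#
  0<1 = 0≤1 , 0≉1

  <⇒≤ : ∀ {x y} → x < y → x ≤ y
  <⇒≤ = proj₁

  >⇒≉0 : ∀ {x} → 0# < x → ¬ (x ≈ 0#)
  >⇒≉0 0<x x≈0 = proj₂ 0<x (sym x≈0)

  <-≤-trans : ∀ {x y z} → x < y → y ≤ z → x < z
  <-≤-trans (x≤y , x≉y) y≤z =
    O.trans x≤y y≤z , λ x≈z → x≉y (O.antisym x≤y (O.trans y≤z (O.reflexive (sym x≈z))))

  <-resp-≈′ : ∀ {x y x′ y′} → x ≈ x′ → y ≈ y′ → x < y → x′ < y′
  <-resp-≈′ x≈x′ y≈y′ (x≤y , x≉y) =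
    ≤-resp-≈ x≈x′ y≈y′ x≤y , λ x′≈y′ → x≉y (trans x≈x′ (trans x′≈y′ (sym y≈y′)))

  0<y-x : ∀ {x y} → x < y → 0# < y - x
  0<y-x (x≤y , x≉y) = 0≤y-x x≤y , λ 0≈y-x → x≉y (sym (x-y≈0⇒x≈y (sym 0≈y-x)))

  <-by : ∀ {x y s} → 0# < s → y - x ≈ s → x < y
  <-by {x} {y} (0≤s , 0≉s) y-x≈s = ≤-by 0≤s y-x≈s , λ x≈y →
    0≉s (trans (sym (-‿inverseʳ y)) (trans (+-congˡ (-‿cong (sym x≈y))) y-x≈s))

  x*y≈0⇒y≈0 : ∀ {x y} → ¬ (x ≈ 0#) → x * y ≈ 0# → y ≈ 0#
  x*y≈0⇒y≈0 {x} {y} x≉0 xy≈0 = begin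
    y              ≈⟨ *-identityˡ y ⟨
    1# * y         ≈⟨ *-congʳ (*-inverseʳ x≉0) ⟨
    x * x ⁻¹ * y   ≈⟨ solve 3 (λ x i y → x :* i :* y := i :* (x :* y)) refl x (x ⁻¹) y ⟩
    x ⁻¹ * (x * y) ≈⟨ *-congˡ xy≈0 ⟩
    x ⁻¹ * 0#      ≈⟨ zeroʳ _ ⟩
    0#             ∎
    where open ≈-Reasoning

  *-cancelˡ-≈ : ∀ {x y z} → ¬ (x ≈ 0#) → x * y ≈ x * z → y ≈ z
  *-cancelˡ-≈ {x} {y} {z} x≉0 xy≈xz = x-y≈0⇒x≈y (x*y≈0⇒y≈0 x≉0 (begin
    x * (y - z)   ≈⟨ solve 3 (λ x y z → x :* (y :- z) := x :* y :- x :* z) refl x y z ⟩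
    x * y - x * z ≈⟨ +-congʳ xy≈xz ⟩
    x * z - x * z ≈⟨ -‿inverseʳ _ ⟩
    0#            ∎))
    where open ≈-Reasoning

  0≤-cancelˡ : ∀ {x y} → 0# < x → 0# ≤ x * y → 0# ≤ y
  0≤-cancelˡ {x} {y} 0<x 0≤xy with O.total 0# y
  ... | inj₁ 0≤y = 0≤y
  ... | inj₂ y≤0 = O.reflexive (sym (x*y≈0⇒y≈0 (>⇒≉0 0<x) (O.antisym
          (≤-by (<⇒≤ 0<x ⊗ 0≤y-x y≤0)
                (solve 2 (λ x y → con (+ 0) :- x :* y := x :* (con (+ 0) :- y)) refl x y))
          0≤xy)))

  ≤-cancelˡ : ∀ {x y z} → 0# < x → x * y ≤ x * z → y ≤ z
  ≤-cancelˡ {x} {y} {z} 0<x xy≤xz = ≤-by (0≤-cancelˡ 0<x (0≤-resp-≈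
    (solve 3 (λ x y z → x :* z :- x :* y := x :* (z :- y)) refl x y z) (0≤y-x xy≤xz))) refl

  0<x*y : ∀ {x y} → 0# < x → 0# < y → 0# < x * y
  0<x*y 0<x 0<y = <⇒≤ 0<x ⊗ <⇒≤ 0<y , λ 0≈xy → >⇒≉0 0<y (x*y≈0⇒y≈0 (>⇒≉0 0<x) (sym 0≈xy))

  0<x+y : ∀ {x y} → 0# < x → 0# ≤ y → 0# < x + y
  0<x+y {x} {y} 0<x 0≤y = <-≤-trans 0<x (≤-by 0≤y (solve 2 (λ x y → x :+ y :- x := y) refl x y))

  *-inverseˡ : ∀ {x} → ¬ (x ≈ 0#) → x ⁻¹ * x ≈ 1#
  *-inverseˡ x≉0 = trans (*-comm _ _) (*-inverseʳ x≉0)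

  0<x⁻¹ : ∀ {x} → 0# < x → 0# < x ⁻¹
  0<x⁻¹ {x} 0<x = 0≤-cancelˡ 0<x (0≤-resp-≈ (sym x*x⁻¹≈1) 0≤1) , λ 0≈x⁻¹ →
    0≉1 (trans (sym (zeroʳ x)) (trans (*-congˡ 0≈x⁻¹) x*x⁻¹≈1))
    where x*x⁻¹≈1 = *-inverseʳ (>⇒≉0 0<x)

  x/y*y≈x : ∀ {x y} → ¬ (y ≈ 0#) → x / y * y ≈ x
  x/y*y≈x {x} {y} y≉0 = trans (*-assoc _ _ _) (trans (*-congˡ (*-inverseˡ y≉0)) (*-identityʳ x))

  0≤fromℕ : ∀ n → 0# ≤ fromℕ n
  0≤fromℕ zero    = O.refl
  0≤fromℕ (suc n) = 0≤1 ⊕ 0≤fromℕ n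

  0<fromℕ[1+n] : ∀ n → 0# < fromℕ (suc n)
  0<fromℕ[1+n] n = 0<x+y 0<1 (0≤fromℕ n)

  fromℕ-mono-≤ : ∀ {m n} → m ℕ.≤ n → fromℕ m ≤ fromℕ n
  fromℕ-mono-≤ {n = n} ℕ.z≤n = 0≤fromℕ n
  fromℕ-mono-≤ (ℕ.s≤s m≤n) = +-monoʳ-≤ 1# (fromℕ-mono-≤ m≤n)

  half : ℝ
  half = (1# + 1#) ⁻¹

  0<2 : 0# < 1# + 1#
  0<2 = 0<x+y 0<1 0≤1

  half+half≈1 : half + half ≈ 1#
  half+half≈1 = trans (solve 1 (λ h → h :+ h := con (+ 2) :* h) refl half) (*-inverseʳ (>⇒≉0 0<2))

  0<half : 0# < half
  0<half = 0<x⁻¹ 0<2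

  -- Square roots

  x²≤y²⇒x≤y : ∀ {x y} → 0# ≤ y → x * x ≤ y * y → x ≤ y
  x²≤y²⇒x≤y {x} {y} 0≤y x²≤y² with O.total x y
  ... | inj₁ x≤y = x≤y
  ... | inj₂ y≤x with x O.≟ y
  ...   | yes x≈y = O.reflexive x≈y
  -- If `y < x`, then `x² - y² = (x - y) (x - y + 2y)` is a product of positive factors.
  ...   | no  x≉y = contradiction
            (0<x*y 0<x-y (0<x+y 0<x-y (0≤y ⊕ 0≤y)))
            λ (0≤s , 0≉s) → 0≉s (O.antisym 0≤s (≤-by (0≤y-x x²≤y²)
              (solve 2 (λ x y → con (+ 0) :- (x :- y) :* (x :- y :+ (y :+ y)) := y :* y :- x :* x)
                refl x y)))
    where 0<x-y = 0<y-x (y≤x , λ y≈x → x≉y (sym y≈x))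

  -- If s² < p then s + e is below the root, where e = (p - s²) / (2s + 1 + p - s²).
  square-below : ∀ {s p} → 0# ≤ s → s * s < p → Σ[ e ∈ ℝ ] 0# < e × (s + e) * (s + e) ≤ p
  square-below {s} {p} 0≤s s²<p =
    g / D , 0<e , below (<⇒≤ 0<e) eD≈g (e≤1 eD≈g)
    where
    g = p - s * s
    0<g = 0<y-x s²<p
    D = 1# + (s + s + g)
    0<D = 0<x+y 0<1 (0≤s ⊕ 0≤s ⊕ <⇒≤ 0<g)
    0<e : 0# < g / D
    0<e = 0<x*y 0<g (0<x⁻¹ 0<D)
    eD≈g : g / D * D ≈ g
    eD≈g = x/y*y≈x (>⇒≉0 0<D)
    e≤1 : ∀ {e} → e * D ≈ g → e ≤ 1#
    e≤1 {e} eD≈g = ≤-cancelˡ 0<D (≤-by (0≤1 ⊕ 0≤s ⊕ 0≤s ⊕ ≈⇒0≤[x-y]*m eD≈g (- 1#))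
      (solve 3 (λ s p e → let g = p :- s :* s ; D = con (+ 1) :+ (s :+ s :+ g) in
         D :* con (+ 1) :- D :* e
           := con (+ 1) :+ s :+ s :+ (e :* D :- g) :* (:- con (+ 1))) refl s p e))
    below : ∀ {e} → 0# ≤ e → e * D ≈ g → e ≤ 1# → (s + e) * (s + e) ≤ p
    below {e} 0≤e eD≈g e≤1 = ≤-by
      (0≤e ⊗ 0≤y-x e≤1 ⊕ 0≤e ⊗ <⇒≤ 0<g ⊕ ≈⇒0≤[x-y]*m eD≈g (- 1#))
      (solve 3 (λ s p e → let g = p :- s :* s ; D = con (+ 1) :+ (s :+ s :+ g) in
         p :- (s :+ e) :* (s :+ e)
           := e :* (con (+ 1) :- e) :+ e :* g :+ (e :* D :- g) :* (:- con (+ 1))) refl s p e)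

  -- Newton's step s - (s² - p) / 2s stays above the root.
  square-above : ∀ {s p} → 0# ≤ s → 0# ≤ p → p < s * s →
                 Σ[ e ∈ ℝ ] 0# < e × e ≤ s × p ≤ (s - e) * (s - e)
  square-above {s} {p} 0≤s 0≤p p<s² =
    g / (s + s) , 0<x*y 0<g (0<x⁻¹ 0<2s) , e≤s 2es≈g , above 2es≈g
    where
    g = s * s - p
    0<g = 0<y-x p<s²
    0<s : 0# < s
    0<s = 0≤s , λ 0≈s → proj₂ p<s² (O.antisym (<⇒≤ p<s²)
      (O.trans (O.reflexive (trans (*-congʳ (sym 0≈s)) (zeroˡ s))) 0≤p))
    0<2s = 0<x+y 0<s 0≤s
    2es≈g : g / (s + s) * (s + s) ≈ g
    2es≈g = x/y*y≈x (>⇒≉0 0<2s)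
    e≤s : ∀ {e} → e * (s + s) ≈ g → e ≤ s
    e≤s {e} 2es≈g = ≤-cancelˡ 0<2s (≤-by (0≤x² s ⊕ 0≤p ⊕ ≈⇒0≤[x-y]*m 2es≈g (- 1#))
      (solve 3 (λ s p e → (s :+ s) :* s :- (s :+ s) :* e
         := s :* s :+ p :+ (e :* (s :+ s) :- (s :* s :- p)) :* (:- con (+ 1))) refl s p e))
    above : ∀ {e} → e * (s + s) ≈ g → p ≤ (s - e) * (s - e)
    above {e} 2es≈g = ≤-by (0≤x² e ⊕ ≈⇒0≤[x-y]*m 2es≈g (- 1#))
      (solve 3 (λ s p e → (s :- e) :* (s :- e) :- p
         := e :* e :+ (e :* (s :+ s) :- (s :* s :- p)) :* (:- con (+ 1))) refl s p e)

  -- The root is the supremum of the nonnegative `x` with `x² ≤ p`, a set bounded by `1 + p`. If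
  -- `s² < p`, then `square-below` yields a larger element of the set; if `p < s²`, then
  -- `square-above` yields a smaller upper bound.
  square-root : ∀ p → 0# ≤ p → Σ[ s ∈ ℝ ] 0# ≤ s × s * s ≈ p
  square-root p 0≤p = root (supremum P (0# , O.refl , 0²≤p) (1# + p , λ x → bounded))
    where
    P : ℝ → Set
    P x = 0# ≤ x × x * x ≤ p

    0²≤p : 0# * 0# ≤ p
    0²≤p = O.trans (O.reflexive (zeroˡ 0#)) 0≤p

    bounded : ∀ {x} → P x → x ≤ 1# + p
    bounded {x} (_ , x²≤p) = x²≤y²⇒x≤y (0≤1 ⊕ 0≤p) (≤-by
      (0≤y-x x²≤p ⊕ 0≤1 ⊕ 0≤p ⊕ 0≤p ⊗ 0≤p)
      (solve 2 (λ p x → (con (+ 1) :+ p) :* (con (+ 1) :+ p) :- x :* x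
                     := (p :- x :* x) :+ con (+ 1) :+ p :+ p :* p) refl p x))

    root : (Σ[ s ∈ ℝ ] UpperBound P s × (∀ u → UpperBound P u → s ≤ u)) →
           Σ[ s ∈ ℝ ] 0# ≤ s × s * s ≈ p
    root (s , s-upper , s-least) = s , 0≤s , s²≈p
      where
      0≤s : 0# ≤ s
      0≤s = s-upper 0# (O.refl , 0²≤p)

      s²≮p : ¬ (s * s < p)
      s²≮p s²<p = let e , 0<e , [s+e]²≤p = square-below 0≤s s²<p in
        proj₂ 0<e (O.antisym (<⇒≤ 0<e) (≤-by
          (0≤y-x (s-upper (s + e) (0≤s ⊕ <⇒≤ 0<e , [s+e]²≤p)))
          (solve 2 (λ s e → con (+ 0) :- e := s :- (s :+ e)) refl s e)))

      p≮s² : ¬ (p < s * s)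
      p≮s² p<s² = let e , 0<e , e≤s , p≤[s-e]² = square-above 0≤s 0≤p p<s² in
        proj₂ 0<e (O.antisym (<⇒≤ 0<e) (≤-by
          (0≤y-x (s-least (s - e) λ x (_ , x²≤p) → x²≤y²⇒x≤y (0≤y-x e≤s) (O.trans x²≤p p≤[s-e]²)))
          (solve 2 (λ s e → con (+ 0) :- e := (s :- e) :- s) refl s e)))

      s²≈p : s * s ≈ p
      s²≈p with (s * s) O.≟ p | O.total (s * s) p
      ... | yes s²≈p | _         = s²≈p
      ... | no s²≉p  | inj₁ s²≤p = contradiction (s²≤p , s²≉p) s²≮p
      ... | no s²≉p  | inj₂ p≤s² = contradiction (p≤s² , s²≉p ∘ sym) p≮s²

  -- Total, with the default value 0 at negative arguments, so that the instance is defined for all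
  -- `δ` and `Δ` before their ratio is restricted.
  √ : ℝ → ℝ
  √ p with O.total 0# p
  ... | inj₁ 0≤p = proj₁ (square-root p 0≤p)
  ... | inj₂ _   = 0#

  √-square : ∀ {p} → 0# ≤ p → √ p * √ p ≈ p
  √-square {p} 0≤p with O.total 0# p
  ... | inj₁ 0≤p′ = proj₂ (proj₂ (square-root p 0≤p′))
  ... | inj₂ p≤0  = trans (zeroˡ 0#) (O.antisym 0≤p p≤0)

  -- Finite sums

  sum-mono-≤ : ∀ {n} {f g : Vector ℝ n} → (∀ i → f i ≤ g i) → sum f ≤ sum g
  sum-mono-≤ {zero}  f≤g = O.refl
  sum-mono-≤ {suc n} f≤g = +-mono-≤ (f≤g zero) (sum-mono-≤ (f≤g ∘ suc))

  0≤sum : ∀ {n} {f : Vector ℝ n} → (∀ i → 0# ≤ f i) → 0# ≤ sum f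
  0≤sum {n} 0≤f = ≤-resp-≈ (sum-replicate-zero n) refl (sum-mono-≤ 0≤f)

  sum-const : ∀ n x → sum {n} (λ _ → x) ≈ fromℕ n * x
  sum-const zero    x = sym (zeroˡ x)
  sum-const (suc n) x = trans (+-congˡ (sum-const n x))
    (solve 2 (λ x n → x :+ n :* x := (con (+ 1) :+ n) :* x) refl x (fromℕ n))

  sum-pairs : ∀ k (f : Vector ℝ (k ℕ.* 2)) →
              sum f ≈ sum λ i → f (combine {k} i zero) + f (combine {k} i (suc zero))
  sum-pairs zero    f = refl
  sum-pairs (suc k) f = trans (sym (+-assoc _ _ _)) (+-congˡ (sum-pairs k (λ i → f (suc (suc i)))))

  -- Only the Boolean `does` is inspected, so indicators compute through the decision procedures:
  -- `𝟙[ suc i ≡ suc j ]` reduces to `𝟙[ i ≡ j ]`, and `χ (x ∷⁺ h) i` is settled by comparing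
  -- `cluster x` with `i` and otherwise reduces to `χ h i`.
  indicator : ∀ {p} {P : Set p} → Dec P → ℝ
  indicator P? = if does P? then 1# else 0#

  𝟙[_≡_] : ∀ {n} → Fin n → Fin n → ℝ
  𝟙[ i ≡ j ] = indicator (i Fin.≟ j)

  sum-select : ∀ {n} (i : Fin n) (f : Vector ℝ n) → sum (λ j → 𝟙[ i ≡ j ] * f j) ≈ f i
  sum-select {suc n} zero f = begin
    1# * f zero + sum (λ j → 0# * f (suc j))
      ≈⟨ +-cong (*-identityˡ _) (sum-cong-≋ λ j → zeroˡ (f (suc j))) ⟩
    f zero + sum {n} (λ _ → 0#) ≈⟨ +-congˡ (sum-replicate-zero n) ⟩
    f zero + 0#                 ≈⟨ +-identityʳ _ ⟩
    f zero                      ∎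
    where open ≈-Reasoning
  sum-select {suc n} (suc i) f = begin
    0# * f zero + sum (λ j → 𝟙[ i ≡ j ] * f (suc j)) ≈⟨ +-cong (zeroˡ _) (sum-select i (f ∘ suc)) ⟩
    0# + f (suc i)                                  ≈⟨ +-identityˡ _ ⟩
    f (suc i)                                       ∎
    where open ≈-Reasoning

  sum-select² : ∀ {n} (i : Fin n) x → sum (λ j → 𝟙[ i ≡ j ] * x * (𝟙[ i ≡ j ] * x)) ≈ x * x
  sum-select² i x = trans (sum-cong-≋ λ j → square (i Fin.≟ j)) (sum-select i (λ _ → x * x))
    where
    square : ∀ {P : Set} (P? : Dec P) → indicator P? * x * (indicator P? * x)
      ≈ indicator P? * (x * x)
    square (yes _) = solve 1 (λ x → con (+ 1) :* x :* (con (+ 1) :* x) := con (+ 1) :* (x :* x))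
      refl x
    square (no _)  = solve 1 (λ x → con (+ 0) :* x :* (con (+ 0) :* x) := con (+ 0) :* (x :* x))
      refl x

  sum-same : ∀ {n} (i : Fin n) x y →
             sum (λ j → (𝟙[ i ≡ j ] * x - 𝟙[ i ≡ j ] * y) * (𝟙[ i ≡ j ] * x - 𝟙[ i ≡ j ] * y))
               ≈ (x - y) * (x - y)
  sum-same i x y = trans
    (sum-cong-≋ λ j → solve 3 (λ c x y →
      (c :* x :- c :* y) :* (c :* x :- c :* y) := c :* (x :- y) :* (c :* (x :- y)))
      refl 𝟙[ i ≡ j ] x y)
    (sum-select² i (x - y))

  -- Pythagoras: the two indicators are never both nonzero, so the cross terms vanish.
  sum-apart : ∀ {n} {i i′ : Fin n} x y → ¬ (i ≡ i′) →
              sum (λ j → (𝟙[ i ≡ j ] * x - 𝟙[ i′ ≡ j ] * y) * (𝟙[ i ≡ j ] * x - 𝟙[ i′ ≡ j ] * y))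
                ≈ x * x + y * y
  sum-apart {i = i} {i′} x y i≢i′ = begin
    sum (λ j → (𝟙[ i ≡ j ] * x - 𝟙[ i′ ≡ j ] * y) * (𝟙[ i ≡ j ] * x - 𝟙[ i′ ≡ j ] * y))
      ≈⟨ sum-cong-≋ (λ j → expand (i Fin.≟ j) (i′ Fin.≟ j)
        λ i≡j i′≡j → i≢i′ (≡.trans i≡j (≡.sym i′≡j))) ⟩
    sum (λ j → 𝟙[ i ≡ j ] * x * (𝟙[ i ≡ j ] * x) + 𝟙[ i′ ≡ j ] * y * (𝟙[ i′ ≡ j ] * y))
      ≈⟨ ∑-distrib-+ (λ j → 𝟙[ i ≡ j ] * x * (𝟙[ i ≡ j ] * x))
        (λ j → 𝟙[ i′ ≡ j ] * y * (𝟙[ i′ ≡ j ] * y)) ⟩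
    sum (λ j → 𝟙[ i ≡ j ] * x * (𝟙[ i ≡ j ] * x)) + sum (λ j → 𝟙[ i′ ≡ j ] * y * (𝟙[ i′ ≡ j ] * y))
      ≈⟨ +-cong (sum-select² i x) (sum-select² i′ y) ⟩
    x * x + y * y ∎
    where
    open ≈-Reasoning
    expand : ∀ {P Q : Set} (P? : Dec P) (Q? : Dec Q) → (P → ¬ Q) →
             (indicator P? * x - indicator Q? * y) * (indicator P? * x - indicator Q? * y)
             ≈ indicator P? * x * (indicator P? * x) + indicator Q? * y * (indicator Q? * y)
    expand (yes p) (yes q) disjoint = contradiction q (disjoint p)
    expand (yes _) (no _)  _ = solve 2 (λ x y →
      (con (+ 1) :* x :- con (+ 0) :* y) :* (con (+ 1) :* x :- con (+ 0) :* y)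
        := con (+ 1) :* x :* (con (+ 1) :* x) :+ con (+ 0) :* y :* (con (+ 0) :* y)) refl x y
    expand (no _)  (yes _) _ = solve 2 (λ x y →
      (con (+ 0) :* x :- con (+ 1) :* y) :* (con (+ 0) :* x :- con (+ 1) :* y)
        := con (+ 0) :* x :* (con (+ 0) :* x) :+ con (+ 1) :* y :* (con (+ 1) :* y)) refl x y
    expand (no _)  (no _)  _ = solve 2 (λ x y →
      (con (+ 0) :* x :- con (+ 0) :* y) :* (con (+ 0) :* x :- con (+ 0) :* y)
        := con (+ 0) :* x :* (con (+ 0) :* x) :+ con (+ 0) :* y :* (con (+ 0) :* y)) refl x y

  -- Cluster i lives in the i-th of k mutually orthogonal planes, where its two
  -- points are (R, δ/2) and (R, -δ/2); distinct clusters are then at squared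
  -- distance 2 (R² + δ²/4).
  module Instance (k : ℕ) (δ Δ : ℝ) where

    -- The solution of `2 (R² + δ²/4) = Δ²`.
    R : ℝ
    R = √ (half * (Δ * Δ - half * (δ * δ)))

    offset : Fin 2 → ℝ
    offset zero       = half * δ
    offset (suc zero) = - (half * δ)

    planePoint : Fin 2 → Fin 2 → ℝ
    planePoint _ zero       = R
    planePoint j (suc zero) = offset j

    coordinate : Fin (k ℕ.* 2) → Fin k × Fin 2 → ℝ
    coordinate x (i , j) = 𝟙[ quotient {k} 2 x ≡ i ] * planePoint (remainder {k} 2 x) j

    points : Points (k ℕ.* 2) (k ℕ.* 2)
    points x z = coordinate x (remQuot {k} 2 z)

    private
      term : Fin (k ℕ.* 2) → Fin (k ℕ.* 2) → Fin k × Fin 2 → ℝ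
      term x y p = (coordinate x p - coordinate y p) * (coordinate x p - coordinate y p)

      distance-split : ∀ x y → ‖ points x - points y ‖² ≈
                       sum (λ i → term x y (i , zero)) + sum (λ i → term x y (i , suc zero))
      distance-split x y = begin
        sum (λ z → term x y (remQuot {k} 2 z))
          ≈⟨ sum-pairs k (λ z → term x y (remQuot {k} 2 z)) ⟩
        sum (λ i → term x y (remQuot {k} 2 (combine {k} i zero)) +
                   term x y (remQuot {k} 2 (combine {k} i (suc zero))))
          ≈⟨ sum-cong-≋ (λ i →
               +-cong (reflexive (≡.cong (term x y) (Fin.remQuot-combine {k} i zero)))
                      (reflexive (≡.cong (term x y) (Fin.remQuot-combine {k} i (suc zero))))) ⟩
        sum (λ i → term x y (i , zero) + term x y (i , suc zero))
          ≈⟨ ∑-distrib-+ (λ i → term x y (i , zero)) (λ i → term x y (i , suc zero)) ⟩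
        sum (λ i → term x y (i , zero)) + sum (λ i → term x y (i , suc zero)) ∎
        where open ≈-Reasoning

      half²-cancel : ∀ {h s} → h + h ≈ 1# → (h * s + h * s) * (h * s + h * s) ≈ s * s
      half²-cancel {h} {s} 2h≈1 = begin
        (h * s + h * s) * (h * s + h * s)   ≈⟨ solve 2 (λ h s →
          (h :* s :+ h :* s) :* (h :* s :+ h :* s) := (h :+ h) :* s :* ((h :+ h) :* s)) refl h s ⟩
        (h + h) * s * ((h + h) * s)         ≈⟨ *-cong (*-congʳ 2h≈1) (*-congʳ 2h≈1) ⟩
        1# * s * (1# * s)                   ≈⟨ *-cong (*-identityˡ s) (*-identityˡ s) ⟩
        s * s                               ∎
        where open ≈-Reasoning

      offset-distance : ∀ j j′ → ¬ (j ≡ j′) →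
        (offset j - offset j′) * (offset j - offset j′) ≈ δ * δ
      offset-distance zero       zero       j≢j′ = contradiction ≡.refl j≢j′
      offset-distance zero       (suc zero) j≢j′ = trans
        (solve 1 (λ t → (t :- :- t) :* (t :- :- t) := (t :+ t) :* (t :+ t)) refl (half * δ))
        (half²-cancel half+half≈1)
      offset-distance (suc zero) zero       j≢j′ = trans
        (solve 1 (λ t → (:- t :- t) :* (:- t :- t) := (t :+ t) :* (t :+ t)) refl (half * δ))
        (half²-cancel half+half≈1)
      offset-distance (suc zero) (suc zero) j≢j′ = contradiction ≡.refl j≢j′

      offset-square : ∀ j → offset j * offset j
        ≈ (half * δ) * (half * δ)
      offset-square zero       = refl
      offset-square (suc zero) = solve 1 (λ t → (:- t) :* (:- t) := t :* t) refl (half * δ)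

    same-distance : ∀ x y → ¬ (x ≡ y) → quotient {k} 2 x ≡ quotient {k} 2 y
      → ‖ points x - points y ‖² ≈ δ * δ
    same-distance x y x≢y cx≡cy = trans (distance-split x y)
      (same (quotient {k} 2 x) (quotient {k} 2 y) cx≡cy λ jx≡jy →
        x≢y (≡.trans (≡.sym (Fin.combine-remQuot {k} 2 x))
            (≡.trans (≡.cong₂ combine cx≡cy jx≡jy) (Fin.combine-remQuot {k} 2 y))))
      where
      open ≈-Reasoning
      jx = remainder {k} 2 x
      jy = remainder {k} 2 y
      -- The clusters are generalised to variables because an equation between two computed
      -- quotients cannot be matched with `refl`.
      same : ∀ i i′ → i ≡ i′ → ¬ (jx ≡ jy) →
        sum (λ l → (𝟙[ i ≡ l ] * R - 𝟙[ i′ ≡ l ] * R) * (𝟙[ i ≡ l ] * R - 𝟙[ i′ ≡ l ] * R)) +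
        sum (λ l → (𝟙[ i ≡ l ] * offset jx - 𝟙[ i′ ≡ l ] * offset jy) *
                   (𝟙[ i ≡ l ] * offset jx - 𝟙[ i′ ≡ l ] * offset jy))
                     ≈ δ * δ
      same i .i ≡.refl jx≢jy = begin
        _ ≈⟨ +-cong (sum-same i R R) (sum-same i (offset jx) (offset jy)) ⟩
        (R - R) * (R - R) + (offset jx - offset jy) * (offset jx - offset jy)
          ≈⟨ solve 2 (λ r s → (r :- r) :* (r :- r) :+ s := s) refl R _ ⟩
        (offset jx - offset jy) * (offset jx - offset jy)
          ≈⟨ offset-distance jx jy jx≢jy ⟩
        δ * δ ∎

    apart-distance : δ * δ ≤ Δ * Δ → ∀ x y → ¬ (quotient {k} 2 x ≡ quotient {k} 2 y)
      → ‖ points x - points y ‖² ≈ Δ * Δ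
    apart-distance δ²≤Δ² x y cx≢cy = begin
      ‖ points x - points y ‖²
        ≈⟨ distance-split x y ⟩
      sum (λ i → term x y (i , zero)) + sum (λ i → term x y (i , suc zero))
        ≈⟨ +-cong (sum-apart R R cx≢cy) (sum-apart (offset jx) (offset jy) cx≢cy) ⟩
      (R * R + R * R) + (offset jx * offset jx + offset jy * offset jy)
        ≈⟨ +-cong (+-cong R² R²) (+-cong (offset-square jx) (offset-square jy)) ⟩
      (r + r) + (half * δ * (half * δ) + half * δ * (half * δ))
        ≈⟨ collect half (Δ * Δ) δ half+half≈1 ⟩
      Δ * Δ ∎
      where
      open ≈-Reasoning
      jx = remainder {k} 2 x
      jy = remainder {k} 2 y
      r = half * (Δ * Δ - half * (δ * δ))
      R² : R * R ≈ r
      -- The radicand is half of `(Δ² - δ²) + δ²/2`, hence nonnegative.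
      R² = √-square (<⇒≤ 0<half ⊗ 0≤-resp-≈
        (trans (solve 3 (λ a b h → (b :- a) :+ h :* a := b :+ (:- con (+ 1) :+ h) :* a)
          refl (δ * δ) (Δ * Δ) half)
               (+-congˡ (trans (*-congʳ h-1≈-h)
                 (solve 2 (λ h a → (:- h) :* a := :- (h :* a)) refl half (δ * δ)))))
        (0≤y-x δ²≤Δ² ⊕ <⇒≤ 0<half ⊗ 0≤x² δ))
        where
        h-1≈-h : - 1# + half ≈ - half
        h-1≈-h = trans (+-congʳ (-‿cong (sym half+half≈1)))
                       (solve 1 (λ h → :- (h :+ h) :+ h := :- h) refl half)
      collect : ∀ h b d → h + h ≈ 1# →
        (h * (b - h * (d * d)) + h * (b - h * (d * d))) + (h * d * (h * d) + h * d * (h * d)) ≈ b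
      collect h b d 2h≈1 = trans
        (solve 3 (λ h b d →
          (h :* (b :- h :* (d :* d)) :+ h :* (b :- h :* (d :* d)))
            :+ (h :* d :* (h :* d) :+ h :* d :* (h :* d))
            := (h :+ h) :* b) refl h b d)
        (trans (*-congʳ 2h≈1) (*-identityˡ b))

  -- Covered clusters and their cost

  module _ {d n} (X : Points d n) where

    cost : History n → Fin n → ℝ
    cost h x = pointCost (X x) (centers X h)

    ‖x-x‖²≈0 : ∀ x → ‖ X x - X x ‖² ≈ 0#
    ‖x-x‖²≈0 x = trans (sum-cong-≋ λ i → solve 1 (λ c → (c :- c) :* (c :- c) := con (+ 0))
      refl (X x i)) (sum-replicate-zero d)

    cost-greatest : ∀ {v} h x → (∀ {y} → y ∈ toList h → v ≤ ‖ X x - X y ‖²) → v ≤ cost h x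
    cost-greatest {v} (y ∷ ys) x = go y ys
      where
      go : ∀ y ys → (∀ {z} → z ∈ y ∷ ys → v ≤ ‖ X x - X z ‖²) → v ≤ cost (y ∷ ys) x
      go y []       v≤ = v≤ (here ≡.refl)
      go y (z ∷ zs) v≤ = ⊓-glb (v≤ (here ≡.refl)) (go z zs (v≤ ∘ there))

    cost-least : ∀ {y} h x → y ∈ toList h → cost h x ≤ ‖ X x - X y ‖²
    cost-least (y ∷ [])     x (here ≡.refl) = O.refl
    cost-least (y ∷ z ∷ zs) x (here ≡.refl) = x⊓y≤x _ _
    cost-least (y ∷ z ∷ zs) x (there y∈h)   = O.trans (x⊓y≤y _ _) (cost-least (z ∷ zs) x y∈h)

    0≤cost : ∀ h x → 0# ≤ cost h x
    0≤cost h x = cost-greatest h x λ {y} _ → 0≤sum λ i → 0≤x² (X x i - X y i)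

  module Clusters (k : ℕ) where

    cluster : Fin (k ℕ.* 2) → Fin k
    cluster = quotient {k} 2

    point : Fin k → Fin 2 → Fin (k ℕ.* 2)
    point = combine {k}

    cluster-point : ∀ i j → cluster (point i j) ≡ i
    cluster-point i j = ≡.cong proj₁ (Fin.remQuot-combine {k} i j)

    Covered : History (k ℕ.* 2) → Fin k → Set
    Covered h i = Any (λ y → cluster y ≡ i) (toList h)

    covered? : ∀ h i → Dec (Covered h i)
    covered? h i = Any.any? (λ y → cluster y Fin.≟ i) (toList h)

    χ : History (k ℕ.* 2) → Fin k → ℝ
    χ h i = indicator (covered? h i)

    -- The number of uncovered clusters, kept as a real so that it can enter the polynomial
    -- certificates.
    U : History (k ℕ.* 2) → ℝ
    U h = sum λ i → 1# - χ h i

    -- Couples the evidence with the value of `χ`, so that a proof can rewrite by that value and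
    -- still use the evidence.
    data χ-View (h : History (k ℕ.* 2)) (i : Fin k) : Set where
      covered   : Covered h i → χ h i ≡ 1# → χ-View h i
      uncovered : ¬ Covered h i → χ h i ≡ 0# → χ-View h i

    χ-view : ∀ h i → χ-View h i
    χ-view h i with covered? h i in eq
    ... | yes c = covered c (≡.cong indicator eq)
    ... | no ¬c = uncovered ¬c (≡.cong indicator eq)

    0≤χ : ∀ h i → 0# ≤ χ h i
    0≤χ h i with χ-view h i
    ... | covered _ χ≡1   rewrite χ≡1 = 0≤1
    ... | uncovered _ χ≡0 rewrite χ≡0 = O.refl

    0≤1-χ : ∀ h i → 0# ≤ 1# - χ h i
    0≤1-χ h i with χ-view h i
    ... | covered _ χ≡1   rewrite χ≡1 = O.reflexive (sym (-‿inverseʳ 1#))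
    ... | uncovered _ χ≡0 rewrite χ≡0 = 0≤-resp-≈
      (solve 0 (con (+ 1) := con (+ 1) :- con (+ 0)) refl) 0≤1

    0≤U : ∀ h → 0# ≤ U h
    0≤U h = 0≤sum (0≤1-χ h)

    χ-[] : ∀ x i → 1# - χ [ x ] i + 𝟙[ cluster x ≡ i ] * 1# ≈ 1#
    χ-[] x i with cluster x Fin.≟ i
    ... | yes _ = solve 0 (con (+ 1) :- con (+ 1) :+ con (+ 1) :* con (+ 1) := con (+ 1)) refl
    ... | no _  = solve 0 (con (+ 1) :- con (+ 0) :+ con (+ 0) :* con (+ 1) := con (+ 1)) refl

    χ-∷ : ∀ x h i → 1# - χ (x ∷⁺ h) i + 𝟙[ cluster x ≡ i ] * (1# - χ h i) ≈ 1# - χ h i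
    χ-∷ x h i with cluster x Fin.≟ i
    ... | yes _ = solve 1 (λ c → con (+ 1) :- con (+ 1) :+ con (+ 1) :* c := c) refl (1# - χ h i)
    ... | no _  = solve 1 (λ c → c :+ con (+ 0) :* c := c) refl (1# - χ h i)

    U-[] : ∀ x → U [ x ] + 1# ≈ fromℕ k
    U-[] x = begin
      U [ x ] + 1#
        ≈⟨ +-congˡ (sum-select (cluster x) (λ _ → 1#)) ⟨
      U [ x ] + sum (λ i → 𝟙[ cluster x ≡ i ] * 1#)
        ≈⟨ ∑-distrib-+ (λ i → 1# - χ [ x ] i) (λ i → 𝟙[ cluster x ≡ i ] * 1#) ⟨
      sum (λ i → 1# - χ [ x ] i + 𝟙[ cluster x ≡ i ] * 1#)
        ≈⟨ sum-cong-≋ (χ-[] x) ⟩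
      sum {k} (λ _ → 1#)
        ≈⟨ trans (sum-const k 1#) (*-identityʳ _) ⟩
      fromℕ k ∎
      where open ≈-Reasoning

    -- A new center affects only the summand of its own cluster, which it sets to zero.
    U-∷ : ∀ x h → U (x ∷⁺ h) + (1# - χ h (cluster x)) ≈ U h
    U-∷ x h = begin
      U (x ∷⁺ h) + (1# - χ h (cluster x))
        ≈⟨ +-congˡ (sum-select (cluster x) (λ i → 1# - χ h i)) ⟨
      U (x ∷⁺ h) + sum (λ i → 𝟙[ cluster x ≡ i ] * (1# - χ h i))
        ≈⟨ ∑-distrib-+ (λ i → 1# - χ (x ∷⁺ h) i) (λ i → 𝟙[ cluster x ≡ i ] * (1# - χ h i)) ⟨
      sum (λ i → 1# - χ (x ∷⁺ h) i + 𝟙[ cluster x ≡ i ] * (1# - χ h i))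
        ≈⟨ sum-cong-≋ (χ-∷ x h) ⟩
      U h ∎
      where open ≈-Reasoning

    U+sum-χ : ∀ h → U h + sum (χ h) ≈ fromℕ k
    U+sum-χ h = begin
      U h + sum (χ h)                 ≈⟨ ∑-distrib-+ (λ i → 1# - χ h i) (χ h) ⟨
      sum (λ i → 1# - χ h i + χ h i)  ≈⟨ sum-cong-≋
        (λ i → solve 1 (λ c → con (+ 1) :- c :+ c := con (+ 1)) refl (χ h i)) ⟩
      sum {k} (λ _ → 1#)              ≈⟨ trans (sum-const k 1#) (*-identityʳ _) ⟩
      fromℕ k                         ∎
      where open ≈-Reasoning

    -- Each center covers at most one further cluster.
    k≤U+length : ∀ h → fromℕ k ≤ U h + fromℕ (List⁺.length h)
    k≤U+length (x ∷ xs) = go x xs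
      where
      go : ∀ x xs → fromℕ k ≤ U (x ∷ xs) + fromℕ (List⁺.length (x ∷ xs))
      go x []       = O.reflexive (trans (sym (U-[] x)) (+-congˡ (sym (+-identityʳ 1#))))
      go x (y ∷ ys) = ≤-by
        (0≤y-x (go y ys) ⊕ 0≤χ (y ∷ ys) (cluster x) ⊕ ≈⇒0≤[x-y]*m (U-∷ x (y ∷ ys)) 1#)
        (solve 5 (λ u′ u l c κ → u′ :+ (con (+ 1) :+ l) :- κ
                               := (u :+ l :- κ) :+ c :+ (u′ :+ (con (+ 1) :- c) :- u) :* con (+ 1))
          refl (U (x ∷ y ∷ ys)) (U (y ∷ ys)) (fromℕ (List⁺.length (y ∷ ys))) (χ (y ∷ ys) (cluster x)) (fromℕ k))

    -- Translates the length condition of `Valid` into the condition under which the total cost is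
    -- positive and may be divided by.
    short⇒1≤U : ∀ h → List⁺.length h ℕ.< k → 1# ≤ U h
    short⇒1≤U h l<k = ≤-by (0≤y-x (k≤U+length h) ⊕ 0≤y-x (fromℕ-mono-≤ l<k))
      (solve 3 (λ u l κ → u :- con (+ 1) := (u :+ l :- κ) :+ (κ :- (con (+ 1) :+ l))) refl
        (U h) (fromℕ (List⁺.length h)) (fromℕ k))

    -- The invariant of a run without a miss. It makes every covered cluster cost exactly `a`, where
    -- in general only `≤ a` is known.
    Spread : History (k ℕ.* 2) → Set
    Spread h = ∀ {y z} → y ∈ toList h → z ∈ toList h → cluster y ≡ cluster z → y ≡ z

    spread-[] : ∀ x → Spread [ x ]
    spread-[] x (here ≡.refl) (here ≡.refl) _ = ≡.refl

    spread-∷ : ∀ {x h} → Spread h → ¬ Covered h (cluster x) → Spread (x ∷⁺ h)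
    spread-∷ g ¬c (here ≡.refl) (here ≡.refl) _ = ≡.refl
    spread-∷ g ¬c (here ≡.refl) (there z∈h)   e = contradiction (lose z∈h (≡.sym e)) ¬c
    spread-∷ g ¬c (there y∈h)   (here ≡.refl) e = contradiction (lose y∈h e) ¬c
    spread-∷ g ¬c (there y∈h)   (there z∈h)   e = g y∈h z∈h e

    record Separated {d} (X : Points d (k ℕ.* 2)) (a b : ℝ) : Set where
      field
        same-cluster : ∀ x y → ¬ (x ≡ y) → cluster x ≡ cluster y → ‖ X x - X y ‖² ≈ a
        apart        : ∀ x y → ¬ (cluster x ≡ cluster y) → ‖ X x - X y ‖² ≈ b

    module _ {d} (X : Points d (k ℕ.* 2)) where

      coveredCost uncoveredCost : History (k ℕ.* 2) → ℝ
      coveredCost   h = sum λ x → χ h (cluster x) * cost X h x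
      uncoveredCost h = sum λ x → (1# - χ h (cluster x)) * cost X h x

      φ-split : ∀ h → φ X (centers X h) ≈ coveredCost h + uncoveredCost h
      φ-split h = begin
        sum (cost X h)
          ≈⟨ sum-cong-≋ (λ x → solve 2 (λ c p → p := c :* p :+ (con (+ 1) :- c) :* p)
            refl (χ h (cluster x)) (cost X h x)) ⟩
        sum (λ x → χ h (cluster x) * cost X h x + (1# - χ h (cluster x)) * cost X h x)
          ≈⟨ ∑-distrib-+ (λ x → χ h (cluster x) * cost X h x)
            (λ x → (1# - χ h (cluster x)) * cost X h x) ⟩
        coveredCost h + uncoveredCost h ∎
        where open ≈-Reasoning

      0≤coveredCost : ∀ h → 0# ≤ coveredCost h
      0≤coveredCost h = 0≤sum λ x → 0≤χ h (cluster x) ⊗ 0≤cost X h x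

      pairCost : History (k ℕ.* 2) → Fin k → ℝ
      pairCost h i = cost X h (point i zero) + cost X h (point i (suc zero))

      coveredCost-pairs : ∀ h → coveredCost h ≈ sum λ i → χ h i * pairCost h i
      coveredCost-pairs h = begin
        coveredCost h
          ≈⟨ sum-pairs k (λ x → χ h (cluster x) * cost X h x) ⟩
        sum (λ i → χ h (cluster (point i zero)) * cost X h (point i zero) +
                   χ h (cluster (point i (suc zero))) * cost X h (point i (suc zero)))
          ≈⟨ sum-cong-≋ (λ i → trans (+-cong (*-congʳ (χ-point i zero))
            (*-congʳ (χ-point i (suc zero)))) (sym (distribˡ _ _ _))) ⟩
        sum (λ i → χ h i * pairCost h i) ∎
        where
        open ≈-Reasoning
        χ-point : ∀ i j → χ h (cluster (point i j)) ≈ χ h i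
        χ-point i j = reflexive (≡.cong (χ h) (cluster-point i j))

      module _ {a b} (0≤a : 0# ≤ a) (a≤b : a ≤ b) (sep : Separated X a b) where
        open Separated sep

        cost-uncovered : ∀ {h} x → ¬ Covered h (cluster x) → cost X h x ≈ b
        cost-uncovered {h} x ¬c = O.antisym
          (O.trans (cost-least X h x head∈h) (O.reflexive (at-b head∈h)))
          (cost-greatest X h x λ y∈h → O.reflexive (sym (at-b y∈h)))
          where
          head∈h = here ≡.refl
          at-b : ∀ {y} → y ∈ toList h → ‖ X x - X y ‖² ≈ b
          at-b y∈h = apart _ _ λ cx≡cy → ¬c (lose y∈h (≡.sym cx≡cy))

        uncoveredCost≈2bU : ∀ h → uncoveredCost h ≈ (b + b) * U h
        uncoveredCost≈2bU h = begin
          uncoveredCost h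
            ≈⟨ sum-cong-≋ (λ x → cost-b x (χ-view h (cluster x))) ⟩
          sum (λ x → (1# - χ h (cluster x)) * b)
            ≈⟨ sum-pairs k (λ x → (1# - χ h (cluster x)) * b) ⟩
          sum (λ i → (1# - χ h (cluster (point i zero))) * b + (1# - χ h (cluster (point i (suc zero)))) * b)
            ≈⟨ sum-cong-≋ (λ i → trans (reflexive (≡.cong₂
              (λ c c′ → (1# - χ h c) * b + (1# - χ h c′) * b) (cluster-point i zero) (cluster-point i (suc zero))))
                                       (solve 2 (λ c b → c :* b :+ c :* b := (b :+ b) :* c)
                                         refl (1# - χ h i) b)) ⟩
          sum (λ i → (b + b) * (1# - χ h i))
            ≈⟨ *-distribˡ-sum (b + b) (λ i → 1# - χ h i) ⟨
          (b + b) * U h ∎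
          where
          open ≈-Reasoning
          cost-b : ∀ x → χ-View h (cluster x) → (1# - χ h (cluster x)) * cost X h x
            ≈ (1# - χ h (cluster x)) * b
          cost-b x (uncovered ¬c _) = *-congˡ (cost-uncovered {h} x ¬c)
          cost-b x (covered _ χ≡1)  rewrite χ≡1 =
            solve 2 (λ p b → (con (+ 1) :- con (+ 1)) :* p := (con (+ 1) :- con (+ 1)) :* b)
              refl (cost X h x) b

        φ≈coveredCost+2bU : ∀ h → φ X (centers X h) ≈ coveredCost h + (b + b) * U h
        φ≈coveredCost+2bU h = trans (φ-split h) (+-congˡ (uncoveredCost≈2bU h))

        cost-center : ∀ {h x} → x ∈ toList h → cost X h x ≤ 0#
        cost-center {h} {x} x∈h = O.trans (cost-least X h x x∈h) (O.reflexive (‖x-x‖²≈0 X x))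

        0≢1 : ¬ (Fin.zero {1} ≡ suc zero)
        0≢1 ()

        same-distance′ : ∀ (i : Fin k) j j′ → ¬ (j ≡ j′) → ‖ X (point i j) - X (point i j′) ‖² ≈ a
        same-distance′ i j j′ j≢j′ = same-cluster _ _ (j≢j′ ∘ Fin.combine-injectiveʳ i j i j′)
          (≡.trans (cluster-point i j) (≡.sym (cluster-point i j′)))

        pair≤a : ∀ {h} i j → point i j ∈ toList h → pairCost h i ≤ a
        pair≤a {h} i zero y∈h = ≤-resp-≈ refl (+-identityˡ a) (+-mono-≤ (cost-center {h} y∈h)
          (O.trans (cost-least X h _ y∈h)
            (O.reflexive (same-distance′ i (suc zero) zero (0≢1 ∘ ≡.sym)))))
        pair≤a {h} i (suc zero) y∈h = ≤-resp-≈ refl (+-identityʳ a) (+-mono-≤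
          (O.trans (cost-least X h _ y∈h)
            (O.reflexive (same-distance′ i zero (suc zero) 0≢1))) (cost-center {h} y∈h))

        center : ∀ {h} i → Covered h i → Σ[ j ∈ Fin 2 ] point i j ∈ toList h
        center {h} i c with y , y∈h , cy≡i ← find c =
          remainder {k} 2 y , ≡.subst (_∈ toList h)
            (≡.trans (≡.sym (Fin.combine-remQuot {k} 2 y)) (≡.cong (λ i → point i (remainder {k} 2 y)) cy≡i)) y∈h

        covered-pair≤a : ∀ h i → Covered h i → pairCost h i ≤ a
        covered-pair≤a h i c = let j , y∈h = center {h} i c in pair≤a {h} i j y∈h

        non-center≥a : ∀ {h x} → ¬ (x ∈ toList h) → a ≤ cost X h x
        non-center≥a {h} {x} x∉h = cost-greatest X h x
          λ {y} y∈h → at-least y y∈h (cluster x Fin.≟ cluster y)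
          where
          at-least : ∀ y → y ∈ toList h → Dec (cluster x ≡ cluster y) → a ≤ ‖ X x - X y ‖²
          at-least y y∈h (yes same) = O.reflexive (sym (same-cluster x y
            (λ { ≡.refl → x∉h y∈h }) same))
          at-least y y∈h (no  diff) = O.trans a≤b (O.reflexive (sym (apart x y diff)))

        -- The sibling of a center cannot be a center as well, so it is at squared distance at least
        -- `a` from every center.
        spread-pair≥a : ∀ h i → Spread h → Covered h i → a ≤ pairCost h i
        spread-pair≥a h i g c = pair≥a (center {h} i c)
          where
          sibling∉ : ∀ j j′ → ¬ (j ≡ j′) → point i j ∈ toList h → ¬ (point i j′ ∈ toList h)
          sibling∉ j j′ j≢j′ y∈h y′∈h = j≢j′ (Fin.combine-injectiveʳ i j i j′
            (g y∈h y′∈h (≡.trans (cluster-point i j) (≡.sym (cluster-point i j′)))))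
          pair≥a : (Σ[ j ∈ Fin 2 ] point i j ∈ toList h) → a ≤ pairCost h i
          pair≥a (zero     , y∈h) = ≤-by
            (0≤y-x (non-center≥a {h} (sibling∉ zero (suc zero) 0≢1 y∈h)) ⊕ 0≤cost X h _)
            (solve 3 (λ p q a → (p :+ q) :- a := (q :- a) :+ p) refl _ _ a)
          pair≥a (suc zero , y∈h) = ≤-by
            (0≤y-x (non-center≥a {h} (sibling∉ (suc zero) zero (0≢1 ∘ ≡.sym) y∈h)) ⊕ 0≤cost X h _)
            (solve 3 (λ p q a → (p :+ q) :- a := (p :- a) :+ q) refl _ _ a)

        sum-χ*a : ∀ h → sum (λ i → χ h i * a) ≈ a * (fromℕ k - U h)
        sum-χ*a h = trans (sym (*-distribʳ-sum a (χ h))) (x-y≈0⇒x≈y (trans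
          (solve 4 (λ s a κ u → s :* a :- a :* (κ :- u) := (u :+ s :- κ) :* a)
            refl (sum (χ h)) a (fromℕ k) (U h))
          (trans (*-congʳ (trans (+-congʳ (U+sum-χ h)) (-‿inverseʳ _))) (zeroˡ a))))

        coveredCost≤ : ∀ h → coveredCost h ≤ a * (fromℕ k - U h)
        coveredCost≤ h = ≤-resp-≈ (sym (coveredCost-pairs h)) (sum-χ*a h) (sum-mono-≤
          λ i → bound i (χ-view h i))
          where
          bound : ∀ i → χ-View h i → χ h i * pairCost h i ≤ χ h i * a
          bound i (covered c χ≡1)   rewrite χ≡1 = ≤-resp-≈ (sym (*-identityˡ _)) (sym
            (*-identityˡ _)) (covered-pair≤a h i c)
          bound i (uncovered _ χ≡0) rewrite χ≡0 = O.reflexive (trans (zeroˡ _) (sym (zeroˡ _)))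

        spread-coveredCost : ∀ h → Spread h → coveredCost h ≈ a * (fromℕ k - U h)
        spread-coveredCost h g = trans (coveredCost-pairs h)
          (trans (sum-cong-≋ λ i → exactly i (χ-view h i)) (sum-χ*a h))
          where
          exactly : ∀ i → χ-View h i → χ h i * pairCost h i ≈ χ h i * a
          exactly i (covered c _)     = *-congˡ
            (O.antisym (covered-pair≤a h i c) (spread-pair≥a h i g c))
          exactly i (uncovered _ χ≡0) rewrite χ≡0 = trans (zeroˡ _) (sym (zeroˡ _))

  -- The expected cost

  infixl 6 _⊞_

  _⊞_ : ∀ {x y} → x ≈ 0# → y ≈ 0# → x + y ≈ 0#
  x≈0 ⊞ y≈0 = trans (+-cong x≈0 y≈0) (+-identityˡ 0#)

  ≈⇒[x-y]*m≈0 : ∀ {x y} → x ≈ y → ∀ m → (x - y) * m ≈ 0#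
  ≈⇒[x-y]*m≈0 {x} {y} x≈y m = trans (*-congʳ (trans (+-congʳ x≈y) (-‿inverseʳ y))) (zeroˡ m)

  ≈-by : ∀ {x y s} → s ≈ 0# → x - y ≈ s → x ≈ y
  ≈-by s≈0 x-y≈s = x-y≈0⇒x≈y (trans x-y≈s s≈0)

  -- One round of sampling from `q`. In the recursion `w` is the indicator of a miss, `B` bounds the
  -- value after a hit, and `G` is what a miss adds; only the total probability of a miss survives
  -- the averaging.
  module Average {n} {q : Vector ℝ n}
    (0≤q : ∀ x → 0# ≤ q x) (Σq≈1 : sum q ≈ 1#) (w : Vector ℝ n) where

    average : ∀ B G → sum (λ x → q x * (B + w x * G)) ≈ B + sum (λ x → w x * q x) * G
    average B G = begin
      sum (λ x → q x * (B + w x * G))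
        ≈⟨ sum-cong-≋ (λ x → solve 4 (λ q B w G → q :* (B :+ w :* G) := q :* B :+ w :* q :* G)
          refl (q x) B (w x) G) ⟩
      sum (λ x → q x * B + w x * q x * G)
        ≈⟨ ∑-distrib-+ (λ x → q x * B) (λ x → w x * q x * G) ⟩
      sum (λ x → q x * B) + sum (λ x → w x * q x * G)
        ≈⟨ +-cong (*-distribʳ-sum B q) (*-distribʳ-sum G (λ x → w x * q x)) ⟨
      sum q * B + sum (λ x → w x * q x) * G
        ≈⟨ +-congʳ (trans (*-congʳ Σq≈1) (*-identityˡ B)) ⟩
      B + sum (λ x → w x * q x) * G ∎
      where open ≈-Reasoning

    average≤ : ∀ {F : Vector ℝ n} B G → (∀ x → F x ≤ B + w x * G) →
               sum (λ x → q x * F x) ≤ B + sum (λ x → w x * q x) * G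
    average≤ {F} B G F≤ = ≤-resp-≈ refl (average B G) (sum-mono-≤ λ x → ≤-by (0≤q x ⊗ 0≤y-x (F≤ x))
      (solve 3 (λ q f g → q :* g :- q :* f := q :* (g :- f)) refl (q x) (F x) _))

    average≥ : ∀ {F : Vector ℝ n} B G → (∀ x → B + w x * G ≤ F x) →
               B + sum (λ x → w x * q x) * G ≤ sum (λ x → q x * F x)
    average≥ {F} B G ≤F = ≤-resp-≈ (average B G) refl (sum-mono-≤ λ x → ≤-by (0≤q x ⊗ 0≤y-x (≤F x))
      (solve 3 (λ q f g → q :* f :- q :* g := q :* (f :- g)) refl (q x) (F x) _))

  -- Harmonic weights

  𝓗-suc : ∀ k → 𝓗 (suc k) ≈ 𝓗 k + 1# / fromℕ (suc k)
  𝓗-suc k = trans (sum-init-last {k} (λ i → 1# / fromℕ (suc (toℕ i)))) (+-cong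
    (sum-cong-≋ {k} λ i → reflexive (≡.cong (λ m → 1# / fromℕ (suc m)) (Fin.toℕ-inject₁ i)))
    (reflexive (≡.cong (λ m → 1# / fromℕ (suc m)) (Fin.toℕ-fromℕ k))))

  -- The weights (κ - j) / j of the rounds in which j clusters are uncovered.
  weightSum : ℝ → ℕ → ℝ
  weightSum κ zero    = 0#
  weightSum κ (suc r) = weightSum κ r + (κ - fromℕ (suc r)) / fromℕ (suc r)

  -- The weight of round `j` is `κ / j - 1`.
  weightSum≈κ𝓗-r : ∀ κ r → weightSum κ r ≈ κ * 𝓗 r - fromℕ r
  weightSum≈κ𝓗-r κ zero    = solve 1 (λ κ → con (+ 0) := κ :* con (+ 0) :- con (+ 0)) refl κ
  weightSum≈κ𝓗-r κ (suc r) = ≈-by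
    (≈⇒[x-y]*m≈0 (weightSum≈κ𝓗-r κ r) 1# ⊞ ≈⇒[x-y]*m≈0 (𝓗-suc r) (- κ)
      ⊞ ≈⇒[x-y]*m≈0 (*-inverseʳ (>⇒≉0 (0<fromℕ[1+n] r))) (- 1#))
    (solve 6 (λ κ s h h′ ρ i → let u = con (+ 1) :+ ρ in
       (s :+ (κ :- u) :* i) :- (κ :* h′ :- u)
         := (s :- (κ :* h :- ρ)) :* con (+ 1) :+ (h′ :- (h :+ con (+ 1) :* i)) :* (:- κ)
           :+ (u :* i :- con (+ 1)) :* (:- con (+ 1)))
      refl κ (weightSum κ r) (𝓗 r) (𝓗 (suc r)) (fromℕ r) (fromℕ (suc r) ⁻¹))

  -- The weight at `j = κ` vanishes, so the sum may be extended by one term; this is how the full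
  -- harmonic number arises although only `κ - 1` rounds carry a weight.
  weightSum-pred : ∀ k → weightSum (fromℕ (suc k)) k ≈ fromℕ (suc k) * 𝓗 (suc k) - fromℕ (suc k)
  weightSum-pred k = ≈-by
    (≈⇒[x-y]*m≈0 (weightSum≈κ𝓗-r κ k) 1# ⊞ ≈⇒[x-y]*m≈0 (𝓗-suc k) (- κ)
      ⊞ ≈⇒[x-y]*m≈0 (*-inverseʳ (>⇒≉0 (0<fromℕ[1+n] k))) (- 1#))
    (solve 5 (λ s h h′ ρ i → let κ = con (+ 1) :+ ρ in
       s :- (κ :* h′ :- κ)
         := (s :- (κ :* h :- ρ)) :* con (+ 1) :+ (h′ :- (h :+ con (+ 1) :* i)) :* (:- κ)
           :+ (κ :* i :- con (+ 1)) :* (:- con (+ 1)))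
      refl (weightSum κ k) (𝓗 k) (𝓗 (suc k)) (fromℕ k) (κ ⁻¹))
    where κ = fromℕ (suc k)

  weight-* : ∀ κ r → (κ - fromℕ (suc r)) / fromℕ (suc r) * fromℕ (suc r) ≈ κ - fromℕ (suc r)
  weight-* κ r = x/y*y≈x (>⇒≉0 (0<fromℕ[1+n] r))

  0≤weight : ∀ {κ} r → fromℕ (suc r) ≤ κ → 0# ≤ (κ - fromℕ (suc r)) / fromℕ (suc r)
  0≤weight r u≤κ = 0≤y-x u≤κ ⊗ <⇒≤ (0<x⁻¹ (0<fromℕ[1+n] r))

  weight≤κ : ∀ {κ} r → 0# ≤ κ → (κ - fromℕ (suc r)) / fromℕ (suc r) ≤ κ
  weight≤κ {κ} r 0≤κ = ≤-cancelˡ (0<fromℕ[1+n] r) (≤-by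
    (0≤κ ⊗ 0≤fromℕ r ⊕ 0≤fromℕ (suc r) ⊕ ≈⇒0≤[x-y]*m (weight-* κ r) (- 1#))
    (solve 3 (λ κ ρ σ → let u = con (+ 1) :+ ρ in
       u :* κ :- u :* σ := κ :* ρ :+ u :+ (σ :* u :- (κ :- u)) :* (:- con (+ 1)))
     refl κ (fromℕ r) _))

  fromℕ-pred-≤ : ∀ {κ} r → fromℕ (suc r) ≤ κ → fromℕ r ≤ κ
  fromℕ-pred-≤ r = O.trans (≤-by 0≤1
    (solve 1 (λ ρ → con (+ 1) :+ ρ :- ρ := con (+ 1)) refl (fromℕ r)))

  0≤weightSum : ∀ {κ} r → fromℕ r ≤ κ → 0# ≤ weightSum κ r
  0≤weightSum zero    _   = O.refl
  0≤weightSum (suc r) u≤κ = 0≤weightSum r (fromℕ-pred-≤ r u≤κ) ⊕ 0≤weight r u≤κ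

  weightSum≤rκ : ∀ {κ} r → 0# ≤ κ → weightSum κ r ≤ fromℕ r * κ
  weightSum≤rκ {κ} zero    0≤κ = O.reflexive (sym (zeroˡ κ))
  weightSum≤rκ {κ} (suc r) 0≤κ = ≤-by (0≤y-x (weightSum≤rκ r 0≤κ) ⊕ 0≤y-x (weight≤κ r 0≤κ))
    (solve 4 (λ κ ρ s σ → (con (+ 1) :+ ρ) :* κ :- (s :+ σ) := (ρ :* κ :- s) :+ (κ :- σ))
      refl κ (fromℕ r) (weightSum κ r) _)

  0<fromℕ[k*2] : ∀ {k} → 2 ℕ.≤ k → 0# < fromℕ (k ℕ.* 2)
  0<fromℕ[k*2] {suc k} _ = 0<fromℕ[1+n] (suc (k ℕ.* 2))

  -- The recursion over the rounds

  module Recursion (k : ℕ) {d} (X : Points d (k ℕ.* 2)) (a b z : ℝ)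
    (0≤a : 0# ≤ a) (0<b : 0# < b) (a≤b : a ≤ b) (0≤z : 0# ≤ z) (z*b≈a : z * b ≈ a)
    (separated : Clusters.Separated k X a b) where

    open Clusters k

    κ : ℝ
    κ = fromℕ k

    0≤κ : 0# ≤ κ
    0≤κ = 0≤fromℕ k

    0≤b : 0# ≤ b
    0≤b = <⇒≤ 0<b

    Φ Cov : History (k ℕ.* 2) → ℝ
    Φ h = φ X (centers X h)
    Cov h = coveredCost X h

    Φ≈ : ∀ h → Φ h ≈ Cov h + (b + b) * U h
    Φ≈ h = φ≈coveredCost+2bU X 0≤a a≤b separated h

    Cov≤aκ : ∀ h → Cov h ≤ a * κ
    Cov≤aκ h = O.trans (coveredCost≤ X 0≤a a≤b separated h) (≤-by (0≤a ⊗ 0≤U h)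
      (solve 3 (λ a κ u → a :* κ :- a :* (κ :- u) := a :* u) refl a κ (U h)))

    U≤κ : ∀ h → U h ≤ κ
    U≤κ h = ≤-by (0≤sum (0≤χ h) ⊕ ≈⇒0≤[x-y]*m (U+sum-χ h) (- 1#))
      (solve 3 (λ u s κ → κ :- u := s :+ (u :+ s :- κ) :* (:- con (+ 1))) refl (U h) (sum (χ h)) κ)

    0<Φ : ∀ h → 1# ≤ U h → 0# < Φ h
    0<Φ h 1≤U = <-resp-≈′ refl (trans (+-comm _ _) (sym (Φ≈ h)))
      (0<x+y (0<x*y (0<x+y 0<b 0≤b) (<-≤-trans 0<1 1≤U)) (0≤coveredCost X h))

    -- Relative to exact k-means++, the sampler multiplies the probability of
    -- missing the uncovered clusters by c.
    record Boosts (c : ℝ) (A : Sampler (k ℕ.* 2)) : Set where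
      open Sampler A
      field
        first-uniform : ∀ x → first x ≈ 1# / fromℕ (k ℕ.* 2)
        0≤next        : ∀ h → 1# ≤ U h → ∀ x → 0# ≤ next h x
        sum-next      : ∀ h → 1# ≤ U h → sum (next h) ≈ 1#
        covered-mass  : ∀ h → 1# ≤ U h → sum (λ x → χ h (cluster x) * next h x) * Φ h ≈ c * Cov h

    module _ {c A} (0≤c : 0# ≤ c) (boosts : Boosts c A) where
      open Sampler A
      open Boosts boosts

      V : ℕ → History (k ℕ.* 2) → ℝ
      V = expectedFrom X A

      Q : History (k ℕ.* 2) → ℝ
      Q h = sum λ x → χ h (cluster x) * next h x

      module At h (1≤U : 1# ≤ U h) = Average (0≤next h 1≤U) (sum-next h 1≤U) (λ x → χ h (cluster x))

      0≤Q : ∀ h → 1# ≤ U h → 0# ≤ Q h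
      0≤Q h 1≤U = 0≤sum λ x → 0≤χ h (cluster x) ⊗ 0≤next h 1≤U x

      -- `Q` is the probability of a miss. It satisfies `Q Φ = c Cov`, where `Φ ≥ 2b` because a
      -- cluster is uncovered, and `Cov ≤ a κ`. So a miss, though it costs `2b`, contributes only
      -- `O(a)` in expectation.
      2bQ≤ : ∀ h → 1# ≤ U h → Q h * (b + b) ≤ c * (a * κ)
      2bQ≤ h 1≤U = ≤-by
        (0≤c ⊗ 0≤y-x (Cov≤aκ h) ⊕ 0≤Q h 1≤U ⊗ 0≤coveredCost X h ⊕ 0≤Q h 1≤U ⊗
          (0≤b ⊕ 0≤b) ⊗ 0≤y-x 1≤U
          ⊕ ≈⇒0≤[x-y]*m (covered-mass h 1≤U) (- 1#) ⊕ ≈⇒0≤[x-y]*m (Φ≈ h) (Q h))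
        (solve 8 (λ a b c κ q f p u →
          c :* (a :* κ) :- q :* (b :+ b)
            := c :* (a :* κ :- p) :+ q :* p :+ q :* (b :+ b) :* (u :- con (+ 1))
               :+ (q :* f :- c :* p) :* (:- con (+ 1)) :+ (f :- (p :+ (b :+ b) :* u)) :* q)
          refl a b c κ (Q h) (Φ h) (Cov h) (U h))

      Q≤ : ∀ h → 1# ≤ U h → Q h ≤ c * κ * z
      Q≤ h 1≤U = ≤-cancelˡ 0<b (≤-by
        (0≤y-x (2bQ≤ h 1≤U) ⊕ 0≤b ⊗ 0≤Q h 1≤U ⊕ ≈⇒0≤[x-y]*m z*b≈a (c * κ))
        (solve 6 (λ a b c κ z q →
          b :* (c :* κ :* z) :- b :* q
            := (c :* (a :* κ) :- q :* (b :+ b)) :+ b :* q :+ (z :* b :- a) :* (c :* κ))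
          refl a b c κ z (Q h)))

      module _ r h {e} (0≤e : 0# ≤ e) (U≈ : U h ≈ fromℕ (suc r) + e) where
        1≤U : 1# ≤ U h
        1≤U = ≤-by (0≤fromℕ r ⊕ 0≤e ⊕ ≈⇒0≤[x-y]*m U≈ 1#)
          (solve 3 (λ ρ e u → u :- con (+ 1) := ρ :+ e :+ (u :- (con (+ 1) :+ ρ :+ e)) :* con (+ 1))
            refl (fromℕ r) e (U h))

        -- The excess `e` is the number of uncovered clusters beyond those that the remaining rounds
        -- can cover. A hit lowers both counts, a miss only the number of rounds, so exactly the
        -- misses raise the excess.
        U-next : ∀ x → U (x ∷⁺ h) ≈ fromℕ r + (e + χ h (cluster x))
        U-next x = ≈-by (≈⇒[x-y]*m≈0 (U-∷ x h) 1# ⊞ ≈⇒[x-y]*m≈0 U≈ 1#)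
          (solve 5 (λ ρ e u u′ c → u′ :- (ρ :+ (e :+ c))
              := (u′ :+ (con (+ 1) :- c) :- u) :* con (+ 1)
                :+ (u :- (con (+ 1) :+ ρ :+ e)) :* con (+ 1))
            refl (fromℕ r) e (U h) (U (x ∷⁺ h)) (χ h (cluster x)))

      -- Even if all remaining draws are hits, `e` clusters stay uncovered at cost `2b` each.
      lower : ∀ r h {e} → 0# ≤ e → U h ≈ fromℕ r + e → (b + b) * e ≤ V r h
      lower zero h {e} 0≤e U≈ = ≤-by
        (0≤coveredCost X h ⊕ ≈⇒0≤[x-y]*m (Φ≈ h) 1# ⊕ ≈⇒0≤[x-y]*m U≈ (b + b))
        (solve 5 (λ b f p u e → f :- (b :+ b) :* e
            := p :+ (f :- (p :+ (b :+ b) :* u)) :* con (+ 1) :+ (u :- (con (+ 0) :+ e)) :* (b :+ b))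
          refl b (Φ h) (Cov h) (U h) e)
      lower (suc r) h {e} 0≤e U≈ = O.trans
        (≤-by (0≤Q h 1≤u ⊗ (0≤b ⊕ 0≤b))
          (solve 2 (λ p q → p :+ q :- p := q) refl ((b + b) * e) (Q h * (b + b))))
        (At.average≥ h 1≤u ((b + b) * e) (b + b) λ x → ≤-resp-≈
          (solve 3 (λ b e c → (b :+ b) :* (e :+ c) := (b :+ b) :* e :+ c :* (b :+ b))
            refl b e (χ h (cluster x))) refl
          (lower r (x ∷⁺ h) (0≤e ⊕ 0≤χ h (cluster x)) (U-next r h 0≤e U≈ x)))
        where 1≤u = 1≤U r h 0≤e U≈

      -- The covered clusters cost at most `a κ` at the end, and by `2bQ≤` each remaining round adds
      -- at most `c a κ` in expectation. The history is arbitrary, so this applies after a miss.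
      upper : ∀ r h {e} → 0# ≤ e → U h ≈ fromℕ r + e → V r h
        ≤ (b + b) * e + a * κ * (1# + c * fromℕ r)
      upper zero h {e} 0≤e U≈ = ≤-by
        (0≤y-x (Cov≤aκ h) ⊕ ≈⇒0≤[x-y]*m (Φ≈ h) (- 1#) ⊕ ≈⇒0≤[x-y]*m U≈ (- (b + b)))
        (solve 8 (λ a κ c b f p u e → (b :+ b) :* e :+ a :* κ :* (con (+ 1) :+ c :* con (+ 0)) :- f
            := (a :* κ :- p) :+ (f :- (p :+ (b :+ b) :* u)) :* (:- con (+ 1))
              :+ (u :- (con (+ 0) :+ e)) :* (:- (b :+ b)))
          refl a κ c b (Φ h) (Cov h) (U h) e)
      upper (suc r) h {e} 0≤e U≈ = O.trans
        (At.average≤ h 1≤u ((b + b) * e + a * κ * (1# + c * fromℕ r)) (b + b) λ x → ≤-resp-≈ refl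
          (solve 4 (λ b e c K → (b :+ b) :* (e :+ c) :+ K := (b :+ b) :* e :+ K :+ c :* (b :+ b))
            refl b e (χ h (cluster x)) _)
          (upper r (x ∷⁺ h) (0≤e ⊕ 0≤χ h (cluster x)) (U-next r h 0≤e U≈ x)))
        (≤-by (0≤y-x (2bQ≤ h 1≤u))
          (solve 7 (λ a b c κ ρ e q →
            (b :+ b) :* e :+ a :* κ :* (con (+ 1) :+ c :* (con (+ 1) :+ ρ))
              :- ((b :+ b) :* e :+ a :* κ :* (con (+ 1) :+ c :* ρ) :+ q :* (b :+ b))
              := c :* (a :* κ) :- q :* (b :+ b))
            refl a b c κ (fromℕ r) e (Q h)))
        where 1≤u = 1≤U r h 0≤e U≈

      -- The first-order expected cost of a spread history with `r` rounds left and `r` clusters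
      -- uncovered.
      T : ℕ → ℝ
      T r = a * (κ + c * weightSum κ r)

      -- E z a bounds the terms of second order in z that a single round adds to
      -- the distance of the expected cost from T.
      E : ℝ
      E = c * κ * (κ + κ + c * (κ * κ))

      err : ℕ → ℝ
      err r = fromℕ r * (E * (z * a))

      0≤E : 0# ≤ E
      0≤E = 0≤c ⊗ 0≤κ ⊗ (0≤κ ⊕ 0≤κ ⊕ 0≤c ⊗ (0≤κ ⊗ 0≤κ))

      0≤err : ∀ r → 0# ≤ err r
      0≤err r = 0≤fromℕ r ⊗ (0≤E ⊗ (0≤z ⊗ 0≤a))

      module SpreadStep {r h} (g : Spread h) (U≈ : U h ≈ fromℕ (suc r)) where
        σ ρ : ℝ
        σ = (κ - fromℕ (suc r)) / fromℕ (suc r)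
        ρ = fromℕ r

        U≈′ : U h ≈ fromℕ (suc r) + 0#
        U≈′ = trans U≈ (sym (+-identityʳ _))

        1≤u : 1# ≤ U h
        1≤u = 1≤U r h O.refl U≈′

        u≤κ : fromℕ (suc r) ≤ κ
        u≤κ = ≤-resp-≈ U≈ refl (U≤κ h)

        ρ≤κ : ρ ≤ κ
        ρ≤κ = fromℕ-pred-≤ r u≤κ

        -- With `u` clusters uncovered, a spread history has `Cov = a (κ - u) = a σ u`, so
        -- `Q (Cov + 2 b u) = c Cov` can be divided by `u`. The first term is the increment
        -- `T (suc r) - T r`; the second is `O(z a)` since `Q` is `O(z)`.
        2bQ≈ : Q h * (b + b) ≈ c * a * σ - Q h * a * σ
        2bQ≈ = *-cancelˡ-≈ (>⇒≉0 (0<fromℕ[1+n] r)) (≈-by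
          (≈⇒[x-y]*m≈0 (covered-mass h 1≤u) 1# ⊞ ≈⇒[x-y]*m≈0 (Φ≈ h) (- Q h)
            ⊞ ≈⇒[x-y]*m≈0 (spread-coveredCost X 0≤a a≤b separated h g) (c - Q h)
            ⊞ ≈⇒[x-y]*m≈0 U≈ (Q h * a - c * a - (b + b) * Q h)
              ⊞ ≈⇒[x-y]*m≈0 (weight-* κ r) (Q h * a - c * a))
          (solve 10 (λ a b c κ q f p u σ v →
            v :* (q :* (b :+ b)) :- v :* (c :* a :* σ :- q :* a :* σ)
              := (q :* f :- c :* p) :* con (+ 1) :+ (f :- (p :+ (b :+ b) :* u)) :* (:- q)
                 :+ (p :- a :* (κ :- u)) :* (c :- q)
                   :+ (u :- v) :* (q :* a :- c :* a :- (b :+ b) :* q)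
                 :+ (σ :* v :- (κ :- v)) :* (q :* a :- c :* a))
            refl a b c κ (Q h) (Φ h) (Cov h) (U h) σ (fromℕ (suc r))))

        -- The part `2bQ ≤ c a σ` pays for the increment of `T`. The rest is at most `c κ z` times
        -- `a (κ + c κ²)`, which fits into `E z a`.
        miss-upper : (T r + err r) + Q h * ((b + b) * 1# + a * κ * (1# + c * ρ))
          ≤ T (suc r) + err (suc r)
        miss-upper = ≤-by
          (0≤Q h 1≤u ⊗ 0≤a ⊗ 0≤weight r u≤κ
            ⊕ 0≤y-x (Q≤ h 1≤u) ⊗ (0≤κ ⊗ (0≤1 ⊕ 0≤c ⊗ 0≤fromℕ r)) ⊗ 0≤a
            ⊕ 0≤c ⊗ 0≤κ ⊗ 0≤z ⊗ (0≤κ ⊕ 0≤c ⊗ 0≤κ ⊗ 0≤y-x ρ≤κ) ⊗ 0≤a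
            ⊕ ≈⇒0≤[x-y]*m 2bQ≈ (- 1#))
          (solve 9 (λ a b c κ z q s σ ρ →
            let e = c :* κ :* (κ :+ κ :+ c :* (κ :* κ)) :* (z :* a) ; K = κ :* (con (+ 1) :+ c :* ρ) in
            a :* (κ :+ c :* (s :+ σ)) :+ (con (+ 1) :+ ρ) :* e
              :- (a :* (κ :+ c :* s) :+ ρ :* e :+ q :* ((b :+ b) :* con (+ 1) :+ a :* κ :* (con (+ 1) :+ c :* ρ)))
              := q :* a :* σ
                :+ (c :* κ :* z :- q) :* K :* a :+ c :* κ :* z :* (κ :+ c :* κ :* (κ :- ρ)) :* a
                 :+ (q :* (b :+ b) :- (c :* a :* σ :- q :* a :* σ)) :* (:- con (+ 1)))
            refl a b c κ z (Q h) (weightSum κ r) σ ρ)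

        -- By `2bQ≈` the loss against `T (suc r)` is `Q (a σ + T r)`. The bounds `Q ≤ c κ z`,
        -- `σ ≤ κ` and `T r ≤ a (κ + c κ²)` give precisely `E z a`; this determines the form of `E`.
        miss-lower : T (suc r) - err (suc r) ≤ (T r - err r) + Q h * ((b + b) * 1# - T r)
        miss-lower = ≤-by
          (0≤y-x (Q≤ h 1≤u) ⊗ (0≤κ ⊕ 0≤κ ⊕ 0≤c ⊗ (0≤κ ⊗ 0≤κ)) ⊗ 0≤a
            ⊕ 0≤Q h 1≤u ⊗ (0≤y-x (weight≤κ r 0≤κ)
              ⊕ 0≤c ⊗ (0≤y-x (weightSum≤rκ r 0≤κ) ⊕ 0≤y-x ρ≤κ ⊗ 0≤κ)) ⊗ 0≤a
            ⊕ ≈⇒0≤[x-y]*m 2bQ≈ 1#)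
          (solve 9 (λ a b c κ z q s σ ρ →
            let e = c :* κ :* (κ :+ κ :+ c :* (κ :* κ)) :* (z :* a) in
            a :* (κ :+ c :* s) :- ρ :* e :+ q :* ((b :+ b) :* con (+ 1) :- a :* (κ :+ c :* s))
              :- (a :* (κ :+ c :* (s :+ σ)) :- (con (+ 1) :+ ρ) :* e)
              := (c :* κ :* z :- q) :* (κ :+ κ :+ c :* (κ :* κ)) :* a
                 :+ q :* ((κ :- σ) :+ c :* ((ρ :* κ :- s) :+ (κ :- ρ) :* κ)) :* a
                 :+ (q :* (b :+ b) :- (c :* a :* σ :- q :* a :* σ)) :* con (+ 1))
            refl a b c κ z (Q h) (weightSum κ r) σ ρ)

      spread-base : ∀ {h} → Spread h → U h ≈ 0# → V 0 h ≈ T 0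
      spread-base {h} g U≈0 = ≈-by
        (≈⇒[x-y]*m≈0 (Φ≈ h) 1# ⊞ ≈⇒[x-y]*m≈0 (spread-coveredCost X 0≤a a≤b separated h g) 1#
          ⊞ ≈⇒[x-y]*m≈0 U≈0 (b + b - a))
        (solve 7 (λ a b c κ f p u → f :- a :* (κ :+ c :* con (+ 0))
            := (f :- (p :+ (b :+ b) :* u)) :* con (+ 1) :+ (p :- a :* (κ :- u)) :* con (+ 1)
              :+ (u :- con (+ 0)) :* (b :+ b :- a))
          refl a b c κ (Φ h) (Cov h) (U h))

      -- A hit preserves both hypotheses, so induction applies; after a miss the excess is 1 and
      -- `upper` takes over.
      spread-upper : ∀ r h → Spread h → U h ≈ fromℕ r → V r h ≤ T r + err r
      spread-upper zero    h g U≈ = O.reflexive (trans (spread-base g U≈)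
        (solve 2 (λ t e → t := t :+ con (+ 0) :* e) refl (T 0) (E * (z * a))))
      spread-upper (suc r) h g U≈ = O.trans
        (At.average≤ h 1≤u (T r + err r) ((b + b) * 1# + a * κ * (1# + c * ρ))
          λ x → next≤ x (χ-view h (cluster x)))
        miss-upper
        where
        open SpreadStep {r} {h} g U≈
        next≤ : ∀ x → χ-View h (cluster x) → V r (x ∷⁺ h)
          ≤ (T r + err r) + χ h (cluster x) * ((b + b) * 1# + a * κ * (1# + c * ρ))
        next≤ x (uncovered ¬c χ≡0) = ≤-resp-≈ refl
          (sym (trans (+-congˡ (trans (*-congʳ (reflexive χ≡0)) (zeroˡ _))) (+-identityʳ _)))
          (spread-upper r (x ∷⁺ h) (spread-∷ g ¬c) (trans (U-next r h O.refl U≈′ x)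
            (trans (+-congˡ (trans (+-identityˡ _) (reflexive χ≡0))) (+-identityʳ _))))
        -- The bound from `upper` is the whole coefficient of `χ`; `T r + err r` is nonnegative and
        -- merely adds slack.
        next≤ x (covered _ χ≡1) = O.trans
          (upper r (x ∷⁺ h) 0≤1 (trans (U-next r h O.refl U≈′ x) (+-congˡ
            (trans (+-identityˡ _) (reflexive χ≡1)))))
          (≤-by (0≤a ⊗ (0≤κ ⊕ 0≤c ⊗ 0≤weightSum r ρ≤κ) ⊕ 0≤err r
            ⊕ ≈⇒0≤[x-y]*m (reflexive χ≡1) ((b + b) * 1# + a * κ * (1# + c * ρ)))
            (solve 4 (λ t e c m → t :+ e :+ c :* m :- m := t :+ e :+ (c :- con (+ 1)) :* m)
              refl (T r) (err r) (χ h (cluster x)) _))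

      spread-lower : ∀ r h → Spread h → U h ≈ fromℕ r → T r - err r ≤ V r h
      spread-lower zero    h g U≈ = O.reflexive (trans
        (solve 2 (λ t e → t :- con (+ 0) :* e := t)
          refl (T 0) (E * (z * a))) (sym (spread-base g U≈)))
      spread-lower (suc r) h g U≈ = O.trans
        miss-lower
        (At.average≥ h 1≤u (T r - err r) ((b + b) * 1# - T r) λ x → next≥ x (χ-view h (cluster x)))
        where
        open SpreadStep {r} {h} g U≈
        next≥ : ∀ x → χ-View h (cluster x) → (T r - err r) + χ h (cluster x) * ((b + b) * 1# - T r)
          ≤ V r (x ∷⁺ h)
        next≥ x (uncovered ¬c χ≡0) = ≤-resp-≈
          (sym (trans (+-congˡ (trans (*-congʳ (reflexive χ≡0)) (zeroˡ _))) (+-identityʳ _))) refl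
          (spread-lower r (x ∷⁺ h) (spread-∷ g ¬c) (trans (U-next r h O.refl U≈′ x)
            (trans (+-congˡ (trans (+-identityˡ _) (reflexive χ≡0))) (+-identityʳ _))))
        -- The coefficient of `χ` subtracts `T r`, so that after a miss only `2b - err r` is
        -- claimed.
        next≥ x (covered _ χ≡1) = O.trans
          (≤-by (0≤err r ⊕ ≈⇒0≤[x-y]*m (reflexive χ≡1) (- ((b + b) * 1# - T r)))
            (solve 4 (λ t e c m → m :- (t :- e :+ c :* (m :- t)) := e
              :+ (c :- con (+ 1)) :* (:- (m :- t)))
              refl (T r) (err r) (χ h (cluster x)) ((b + b) * 1#)))
          (lower r (x ∷⁺ h) 0≤1 (trans (U-next r h O.refl U≈′ x) (+-congˡ
            (trans (+-identityˡ _) (reflexive χ≡1)))))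

      module _ (2≤k : 2 ℕ.≤ k) where
        Θ : ℝ
        Θ = κ + c * (κ * 𝓗 k - κ)

        private
          κ≈ : ∀ {k} → 2 ℕ.≤ k → fromℕ k ≈ fromℕ (ℕ.pred k) + 1#
          κ≈ {suc k} _ = +-comm _ _

          S≈ : ∀ {k} → 2 ℕ.≤ k → weightSum (fromℕ k) (ℕ.pred k) ≈ fromℕ k * 𝓗 k - fromℕ k
          S≈ {suc k} _ = weightSum-pred k

          T≈ : T (ℕ.pred k) ≈ a * Θ
          T≈ = *-congˡ (+-congˡ (*-congˡ (S≈ 2≤k)))

          err≤ : err (ℕ.pred k) ≤ κ * (E * (z * a))
          err≤ = ≤-by (0≤1 ⊗ (0≤E ⊗ (0≤z ⊗ 0≤a)) ⊕ ≈⇒0≤[x-y]*m (κ≈ 2≤k) (E * (z * a)))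
            (solve 3 (λ κ ρ e → κ :* e :- ρ :* e := con (+ 1) :* e
              :+ (κ :- (ρ :+ con (+ 1))) :* e) refl
              κ (fromℕ (ℕ.pred k)) (E * (z * a)))

          0≤first : ∀ x → 0# ≤ first x
          0≤first x = 0≤-resp-≈ (sym (first-uniform x)) (0≤1 ⊗ <⇒≤ (0<x⁻¹ (0<fromℕ[k*2] 2≤k)))

          sum-first : sum first ≈ 1#
          sum-first = trans (sum-cong-≋ first-uniform) (trans (sum-const (k ℕ.* 2) _)
            (trans (solve 2 (λ n i → n :* (con (+ 1) :* i) := n :* i) refl (fromℕ (k ℕ.* 2)) _)
              (*-inverseʳ (>⇒≉0 (0<fromℕ[k*2] 2≤k)))))

          U≈ : ∀ x → U [ x ] ≈ fromℕ (ℕ.pred k)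
          U≈ x = ≈-by (≈⇒[x-y]*m≈0 (U-[] x) 1# ⊞ ≈⇒[x-y]*m≈0 (κ≈ 2≤k) 1#)
            (solve 3 (λ u κ ρ → u :- ρ := (u :+ con (+ 1) :- κ) :* con (+ 1)
              :+ (κ :- (ρ :+ con (+ 1))) :* con (+ 1)) refl
              (U [ x ]) κ (fromℕ (ℕ.pred k)))

          -- Every first center leads to the same bounds, so the first round is averaged without a
          -- term for misses.
          module First = Average 0≤first sum-first (λ _ → 0#)

          +0 : ∀ B w → B + w * 0# ≈ B
          +0 = solve 2 (λ B w → B :+ w :* con (+ 0) := B) refl

        expectation≤ : 𝔼 k X A ≤ a * Θ + κ * (E * (z * a))
        expectation≤ = O.trans
          (First.average≤ (T r + err r) 0# λ x → O.trans (spread-upper r [ x ] (spread-[] x) (U≈ x))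
            (O.reflexive (sym (+0 _ _))))
          (O.trans (O.reflexive (+0 _ _)) (≤-by (0≤y-x err≤ ⊕ ≈⇒0≤[x-y]*m T≈ (- 1#))
            (solve 4 (λ t t′ e e′ → t′ :+ e′ :- (t :+ e) := (e′ :- e)
              :+ (t :- t′) :* (:- con (+ 1))) refl (T r) (a * Θ) (err r) _)))
          where r = ℕ.pred k

        expectation≥ : a * Θ - κ * (E * (z * a)) ≤ 𝔼 k X A
        expectation≥ = O.trans
          (O.trans (≤-by (0≤y-x err≤ ⊕ ≈⇒0≤[x-y]*m T≈ 1#)
            (solve 4 (λ t t′ e e′ → t :- e :- (t′ :- e′) := (e′ :- e) :+ (t :- t′) :* con (+ 1))
              refl (T r) (a * Θ) (err r) _))
            (O.reflexive (sym (+0 _ _))))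
          (First.average≥ (T r - err r) 0# λ x → O.trans
            (O.reflexive (+0 _ _)) (spread-lower r [ x ] (spread-[] x) (U≈ x)))
          where r = ℕ.pred k

  -- Covered clusters gain a factor 1 + ε, and the uncovered ones uniformly lose
  -- what restores total probability 1.
  adversary : ∀ (k : ℕ) {d} → ℝ → Points d (k ℕ.* 2) → Sampler (k ℕ.* 2)
  adversary k ε X = record
    { first = Sampler.first (exact X)
    ; next  = λ h x → Sampler.next (exact X) h x *
        (1# + ε * (χ h (cluster x) - (1# - χ h (cluster x)) * (coveredCost X h / uncoveredCost X h)))
    }
    where open Clusters k

  -- Validity of exact sampling and of the adversary

  module Samplers (k : ℕ) (2≤k : 2 ℕ.≤ k) {d} (X : Points d (k ℕ.* 2)) (a b z : ℝ)
    (0≤a : 0# ≤ a) (0<b : 0# < b) (a≤b : a ≤ b) (0≤z : 0# ≤ z) (z*b≈a : z * b ≈ a)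
    (separated : Clusters.Separated k X a b) where

    open Clusters k
    open Recursion k X a b z 0≤a 0<b a≤b 0≤z z*b≈a separated

    uniform : IsDistribution (Sampler.first (exact X))
    uniform = (λ _ → 0≤1 ⊗ <⇒≤ (0<x⁻¹ (0<fromℕ[k*2] 2≤k))) ,
      trans (sum-const (k ℕ.* 2) _) (trans
        (solve 2 (λ n i → n :* (con (+ 1) :* i) := n :* i) refl (fromℕ (k ℕ.* 2)) _)
          (*-inverseʳ (>⇒≉0 (0<fromℕ[k*2] 2≤k))))

    0≤exact : ∀ h → 1# ≤ U h → ∀ x → 0# ≤ Sampler.next (exact X) h x
    0≤exact h 1≤U x = 0≤cost X h x ⊗ <⇒≤ (0<x⁻¹ (0<Φ h 1≤U))

    exact-boosts : Boosts 1# (exact X)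
    exact-boosts = record
      { first-uniform = λ _ → refl
      ; 0≤next        = 0≤exact
      ; sum-next      = λ h 1≤U → trans (sym (*-distribʳ-sum (Φ h ⁻¹) (cost X h)))
        (*-inverseʳ (>⇒≉0 (0<Φ h 1≤U)))
      ; covered-mass  = λ h 1≤U → trans (*-congʳ (trans
          (sum-cong-≋ λ x → sym (*-assoc (χ h (cluster x)) (cost X h x) (Φ h ⁻¹)))
          (sym (*-distribʳ-sum (Φ h ⁻¹) (λ x → χ h (cluster x) * cost X h x)))))
          (trans (x/y*y≈x (>⇒≉0 (0<Φ h 1≤U))) (sym (*-identityˡ _)))
      }

    -- Exact sampling stands in for the adversary when `ε` is zero, and its first round is also that
    -- of the adversary.
    exact-valid : ∀ {ε} → 0# ≤ ε → Valid ε k X (exact X)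
    exact-valid {ε} 0≤ε = record
      { first-distribution = uniform
      ; first-noisy        = λ x → noisy (proj₁ uniform x)
      ; next-distribution  =
        λ h l<k → 0≤exact h (short⇒1≤U h l<k) , Boosts.sum-next exact-boosts h (short⇒1≤U h l<k)
      ; next-noisy         = λ h l<k x → noisy (0≤exact h (short⇒1≤U h l<k) x)
      }
      where
      noisy : ∀ {p} → 0# ≤ p → (1# - ε) * p ≤ p × p ≤ (1# + ε) * p
      noisy {p} 0≤p =
        ≤-by (0≤ε ⊗ 0≤p) (solve 2 (λ ε p → p :- (con (+ 1) :- ε) :* p := ε :* p) refl ε p) ,
        ≤-by (0≤ε ⊗ 0≤p) (solve 2 (λ ε p → (con (+ 1) :+ ε) :* p :- p := ε :* p) refl ε p)

    module Adversary {ε} (0≤ε : 0# ≤ ε) (ε<1 : ε < 1#) (aκ≤b : a * κ ≤ b) where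

      A : Sampler (k ℕ.* 2)
      A = adversary k ε X

      Unc τ : History (k ℕ.* 2) → ℝ
      Unc h = uncoveredCost X h
      τ h = Cov h / Unc h

      Unc≈ : ∀ h → Unc h ≈ (b + b) * U h
      Unc≈ = uncoveredCost≈2bU X 0≤a a≤b separated

      module _ h (1≤U : 1# ≤ U h) where
        0<Unc : 0# < Unc h
        0<Unc = <-resp-≈′ refl (sym (Unc≈ h)) (0<x*y (0<x+y 0<b 0≤b) (<-≤-trans 0<1 1≤U))

        τ*Unc≈Cov : τ h * Unc h ≈ Cov h
        τ*Unc≈Cov = x/y*y≈x (>⇒≉0 0<Unc)

        0≤τ : 0# ≤ τ h
        0≤τ = 0≤coveredCost X h ⊗ <⇒≤ (0<x⁻¹ 0<Unc)

        -- `Cov ≤ a κ ≤ b ≤ 2 b U = Unc`. The uncovered clusters are scaled by `1 - ε τ`, which is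
        -- admissible noise because of this bound.
        τ≤1 : τ h ≤ 1#
        τ≤1 = ≤-cancelˡ 0<Unc (≤-by
          (0≤y-x (Cov≤aκ h) ⊕ 0≤y-x aκ≤b ⊕ 0≤b ⊗ (0≤y-x 1≤U ⊕ 0≤U h) ⊕ ≈⇒0≤[x-y]*m (Unc≈ h) 1#
            ⊕ ≈⇒0≤[x-y]*m τ*Unc≈Cov (- 1#))
          (solve 7 (λ a b κ p n u t → n :* con (+ 1) :- n :* t
              := (a :* κ :- p) :+ (b :- a :* κ) :+ b :* (u :- con (+ 1) :+ u)
                 :+ (n :- (b :+ b) :* u) :* con (+ 1) :+ (t :* n :- p) :* (:- con (+ 1)))
            refl a b κ (Cov h) (Unc h) (U h) (τ h)))

        factor : Fin (k ℕ.* 2) → ℝ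
        factor x = 1# + ε * (χ h (cluster x) - (1# - χ h (cluster x)) * τ h)

        1-ε≤factor : ∀ x → 1# - ε ≤ factor x
        1-ε≤factor x = ≤-by (0≤ε ⊗ (0≤χ h (cluster x) ⊕ 0≤χ h (cluster x)
          ⊕ 0≤1-χ h (cluster x) ⊗ 0≤y-x τ≤1))
          (solve 3 (λ ε c t → con (+ 1) :+ ε :* (c :- (con (+ 1) :- c) :* t) :- (con (+ 1) :- ε)
            := ε :* (c :+ c :+ (con (+ 1) :- c) :* (con (+ 1) :- t)))
              refl ε (χ h (cluster x)) (τ h))

        factor≤1+ε : ∀ x → factor x ≤ 1# + ε
        factor≤1+ε x = ≤-by (0≤ε ⊗ (0≤1-χ h (cluster x) ⊗ (0≤1 ⊕ 0≤τ)))
          (solve 3 (λ ε c t → con (+ 1) :+ ε :- (con (+ 1) :+ ε :* (c :- (con (+ 1) :- c) :* t))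
            := ε :* ((con (+ 1) :- c) :* (con (+ 1) :+ t))) refl ε (χ h (cluster x)) (τ h))

        0≤A-next : ∀ x → 0# ≤ Sampler.next A h x
        0≤A-next x = 0≤exact h 1≤U x ⊗ O.trans (0≤y-x (<⇒≤ ε<1)) (1-ε≤factor x)

        A-noisy : ∀ x → (1# - ε) * Sampler.next (exact X) h x ≤ Sampler.next A h x ×
                        Sampler.next A h x ≤ (1# + ε) * Sampler.next (exact X) h x
        A-noisy x =
          ≤-by (0≤exact h 1≤U x ⊗ 0≤y-x (1-ε≤factor x))
            (solve 3 (λ e p f → p :* f :- e :* p := p :* (f :- e)) refl _ _ _) ,
          ≤-by (0≤exact h 1≤U x ⊗ 0≤y-x (factor≤1+ε x))
            (solve 3 (λ e p f → e :* p :- p :* f := p :* (e :- f)) refl _ _ _)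

        -- The mass `ε Cov / Φ` gained equals the mass `ε τ Unc / Φ` lost, by the choice of `τ`.
        A-sum : sum (Sampler.next A h) ≈ 1#
        A-sum = begin
          sum (Sampler.next A h)
            ≈⟨ sum-cong-≋ (λ x → solve 5 (λ p i e c t →
                 p :* i :* (con (+ 1) :+ e :* (c :- (con (+ 1) :- c) :* t))
                   := c :* p :* (i :* (con (+ 1) :+ e))
                     :+ (con (+ 1) :- c) :* p :* (i :* (con (+ 1) :- e :* t)))
                 refl (cost X h x) (Φ h ⁻¹) ε (χ h (cluster x)) (τ h)) ⟩
          sum (λ x → cov x * (i * (1# + ε)) + unc x * (i * (1# - ε * τ h)))
            ≈⟨ ∑-distrib-+ (λ x → cov x * (i * (1# + ε))) (λ x → unc x * (i * (1# - ε * τ h))) ⟩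
          sum (λ x → cov x * (i * (1# + ε))) + sum (λ x → unc x * (i * (1# - ε * τ h)))
            ≈⟨ +-cong (*-distribʳ-sum (i * (1# + ε)) cov)
              (*-distribʳ-sum (i * (1# - ε * τ h)) unc) ⟨
          Cov h * (i * (1# + ε)) + Unc h * (i * (1# - ε * τ h))
            ≈⟨ ≈-by (≈⇒[x-y]*m≈0 τ*Unc≈Cov (- i * ε) ⊞ ≈⇒[x-y]*m≈0 (φ-split X h) (- i)
              ⊞ ≈⇒[x-y]*m≈0 (*-inverseʳ (>⇒≉0 (0<Φ h 1≤U))) 1#)
               (solve 6 (λ p n i e t f → p :* (i :* (con (+ 1) :+ e)) :+ n :* (i :* (con (+ 1) :- e :* t)) :- con (+ 1)
                 := (t :* n :- p) :* ((:- i) :* e) :+ (f :- (p :+ n)) :* (:- i)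
                   :+ (f :* i :- con (+ 1)) :* con (+ 1))
                refl (Cov h) (Unc h) i ε (τ h) (Φ h)) ⟩
          1# ∎
          where
          open ≈-Reasoning
          i = Φ h ⁻¹
          cov unc : Fin (k ℕ.* 2) → ℝ
          cov x = χ h (cluster x) * cost X h x
          unc x = (1# - χ h (cluster x)) * cost X h x

        A-covered : sum (λ x → χ h (cluster x) * Sampler.next A h x) * Φ h ≈ (1# + ε) * Cov h
        A-covered = begin
          sum (λ x → χ h (cluster x) * Sampler.next A h x) * Φ h
            ≈⟨ *-congʳ (sum-cong-≋ λ x → boosted x (χ-view h (cluster x))) ⟩
          sum (λ x → χ h (cluster x) * cost X h x * (Φ h ⁻¹ * (1# + ε))) * Φ h
            ≈⟨ *-congʳ (*-distribʳ-sum (Φ h ⁻¹ * (1# + ε)) (λ x → χ h (cluster x) * cost X h x)) ⟨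
          Cov h * (Φ h ⁻¹ * (1# + ε)) * Φ h
            ≈⟨ solve 4 (λ p i e f → p :* (i :* e) :* f := f :* i :* (e :* p))
              refl (Cov h) (Φ h ⁻¹) (1# + ε) (Φ h) ⟩
          Φ h * Φ h ⁻¹ * ((1# + ε) * Cov h)
            ≈⟨ trans (*-congʳ (*-inverseʳ (>⇒≉0 (0<Φ h 1≤U)))) (*-identityˡ _) ⟩
          (1# + ε) * Cov h ∎
          where
          open ≈-Reasoning
          boosted : ∀ x → χ-View h (cluster x) →
            χ h (cluster x) * Sampler.next A h x
              ≈ χ h (cluster x) * cost X h x * (Φ h ⁻¹ * (1# + ε))
          boosted x (covered _ χ≡1) rewrite χ≡1 =
            solve 4 (λ p i e t → con (+ 1) :* (p :* i :* (con (+ 1) :+ e :* (con (+ 1) :- (con (+ 1) :- con (+ 1)) :* t)))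
              := con (+ 1) :* p :* (i :* (con (+ 1) :+ e))) refl (cost X h x) (Φ h ⁻¹) ε (τ h)
          boosted x (uncovered _ χ≡0) rewrite χ≡0 =
            solve 4 (λ p i e t → con (+ 0) :* (p :* i :* (con (+ 1) :+ e :* (con (+ 0) :- (con (+ 1) :- con (+ 0)) :* t)))
              := con (+ 0) :* p :* (i :* (con (+ 1) :+ e))) refl (cost X h x) (Φ h ⁻¹) ε (τ h)

      A-boosts : Boosts (1# + ε) A
      A-boosts = record
        { first-uniform = λ _ →
          refl ; 0≤next = 0≤A-next ; sum-next = A-sum ; covered-mass = A-covered }

      A-valid : Valid ε k X A
      A-valid = record
        { first-distribution = uniform
        ; first-noisy        = Valid.first-noisy (exact-valid 0≤ε)
        ; next-distribution  = λ h l<k → 0≤A-next h (short⇒1≤U h l<k) , A-sum h (short⇒1≤U h l<k)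
        ; next-noisy         = λ h l<k → A-noisy h (short⇒1≤U h l<k)
        }

  0<-cancelˡ : ∀ {x y} → 0# < x → 0# < x * y → 0# < y
  0<-cancelˡ {x} 0<x (0≤xy , 0≉xy) = 0≤-cancelˡ 0<x 0≤xy ,
    λ 0≈y → 0≉xy (trans (sym (zeroʳ x)) (*-congˡ 0≈y))

  -- The limit

  -- The first two terms already sum to `3/2`. Equivalently `(𝓗 k - 1) / 𝓗 k ≥ 1/3`, the source of
  -- the bound `ε / 3`.
  3≤2𝓗 : ∀ {k} → 2 ℕ.≤ k → 1# + 1# + 1# ≤ (1# + 1#) * 𝓗 k
  3≤2𝓗 {suc (suc k)} (ℕ.s≤s (ℕ.s≤s _)) = ≤-by
    ((0≤1 ⊕ 0≤1) ⊗ 0≤rest ⊕ ≈⇒0≤[x-y]*m (*-inverseʳ (>⇒≉0 (0<fromℕ[1+n] 0))) (1# + 1#)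
      ⊕ ≈⇒0≤[x-y]*m (*-inverseʳ (>⇒≉0 (0<fromℕ[1+n] 1))) 1#)
    (solve 3 (λ i j r → con (+ 2) :* (con (+ 1) :* i
      :+ (con (+ 1) :* j :+ r)) :- (con (+ 1) :+ con (+ 1) :+ con (+ 1))
       := con (+ 2) :* r :+ ((con (+ 1) :+ con (+ 0)) :* i :- con (+ 1)) :* con (+ 2)
          :+ ((con (+ 1) :+ (con (+ 1) :+ con (+ 0))) :* j :- con (+ 1)) :* con (+ 1))
      refl (fromℕ 1 ⁻¹) (fromℕ 2 ⁻¹) (sum tail))
    where
    tail : Vector ℝ k
    tail i = 1# / fromℕ (suc (Fin.toℕ (suc (suc i))))
    0≤rest : 0# ≤ sum tail
    0≤rest = 0≤sum {f = tail} λ i → 0≤1 ⊗ <⇒≤ (0<x⁻¹ (0<fromℕ[1+n] (Fin.toℕ (suc (suc i)))))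

  module Ratio {δ Δ M} (0<δ : 0# < δ) (0<Δ : 0# < Δ) (1≤M : 1# ≤ M) (M≤Δ/δ : M ≤ Δ / δ) where
    y z : ℝ
    y = δ * Δ ⁻¹
    z = y * y

    0<z : 0# < z
    0<z = 0<x*y (0<x*y 0<δ (0<x⁻¹ 0<Δ)) (0<x*y 0<δ (0<x⁻¹ 0<Δ))

    z*Δ²≈δ² : z * (Δ * Δ) ≈ δ * δ
    z*Δ²≈δ² = ≈-by (≈⇒[x-y]*m≈0 (*-inverseʳ (>⇒≉0 0<Δ)) (δ * δ * (Δ * Δ ⁻¹ + 1#)))
      (solve 3 (λ d D i → d :* i :* (d :* i) :* (D :* D) :- d :* d
        := (D :* i :- con (+ 1)) :* (d :* d :* (D :* i :+ con (+ 1))))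
        refl δ Δ (Δ ⁻¹))

    t*y≈1 : Δ / δ * y ≈ 1#
    t*y≈1 = ≈-by (≈⇒[x-y]*m≈0 (*-inverseʳ (>⇒≉0 0<Δ)) (δ * δ ⁻¹)
      ⊞ ≈⇒[x-y]*m≈0 (*-inverseʳ (>⇒≉0 0<δ)) 1#)
      (solve 4 (λ d D i j → D :* j :* (d :* i) :- con (+ 1) := (D :* i :- con (+ 1)) :* (d :* j)
        :+ (d :* j :- con (+ 1)) :* con (+ 1))
        refl δ Δ (Δ ⁻¹) (δ ⁻¹))

    -- With `t = Δ / δ` one has `z t² = 1` and `1 ≤ M ≤ t`, so `z M ≤ z t ≤ z t² = 1`.
    z*M≤1 : z * M ≤ 1#
    z*M≤1 = ≤-by
      (<⇒≤ 0<z ⊗ 0≤y-x M≤Δ/δ ⊕ <⇒≤ 0<z ⊗ O.trans 0≤1 1≤t ⊗ 0≤y-x 1≤t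
        ⊕ ≈⇒0≤[x-y]*m t*y≈1 (- (Δ / δ * y + 1#)))
      (solve 3 (λ t y M → con (+ 1) :- y :* y :* M
          := y :* y :* (t :- M) :+ y :* y :* t :* (t :- con (+ 1))
            :+ (t :* y :- con (+ 1)) :* (:- (t :* y :+ con (+ 1))))
        refl (Δ / δ) y M)
      where
      1≤t : 1# ≤ Δ / δ
      1≤t = O.trans 1≤M M≤Δ/δ

    z*N≤1 : ∀ {N} → N ≤ M → z * N ≤ 1#
    z*N≤1 {N} N≤M = O.trans (≤-by (<⇒≤ 0<z ⊗ 0≤y-x N≤M)
      (solve 3 (λ z M N → z :* M :- z :* N := z :* (M :- N)) refl z M N)) z*M≤1

    δ²*N≤Δ² : ∀ {N} → N ≤ M → δ * δ * N ≤ Δ * Δ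
    δ²*N≤Δ² {N} N≤M = ≤-by (0≤x² Δ ⊗ 0≤y-x (z*N≤1 N≤M) ⊕ ≈⇒0≤[x-y]*m z*Δ²≈δ² N)
      (solve 4 (λ a b z N → b :- a :* N := b :* (con (+ 1) :- z :* N) :+ (z :* b :- a) :* N)
        refl (δ * δ) (Δ * Δ) z N)

  module Quotient {a z EA E₀ ΘA Θ₀ NA N₀ L}
    (0<a : 0# < a) (0≤L : 0# ≤ L) (ΘA≈LΘ₀ : ΘA ≈ L * Θ₀) (2≤Θ₀ : 1# + 1# ≤ Θ₀) (z*N₀≤1 : z * N₀
      ≤ 1#)
    (EA≤ : EA ≤ a * ΘA + NA * (z * a)) (EA≥ : a * ΘA - NA * (z * a) ≤ EA)
    (E₀≤ : E₀ ≤ a * Θ₀ + N₀ * (z * a)) (E₀≥ : a * Θ₀ - N₀ * (z * a) ≤ E₀) where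

    -- `E₀ ≥ a (Θ₀ - z N₀) ≥ a (2 - 1)`. With a denominator of at least `a`, errors of order `z a`
    -- in the numerator become errors of order `z` in the ratio.
    a≤E₀ : a ≤ E₀
    a≤E₀ = ≤-by (0≤y-x E₀≥ ⊕ <⇒≤ 0<a ⊗ (0≤y-x 2≤Θ₀ ⊕ 0≤y-x z*N₀≤1))
      (solve 5 (λ a z e t n → e :- a := (e :- (a :* t :- n :* (z :* a))) :+ a :* ((t :- con (+ 2))
        :+ (con (+ 1) :- z :* n)))
        refl a z E₀ Θ₀ N₀)

    0<E₀ : 0# < E₀
    0<E₀ = <-≤-trans 0<a a≤E₀

    ratio*E₀≈EA : EA / E₀ * E₀ ≈ EA
    ratio*E₀≈EA = x/y*y≈x (>⇒≉0 0<E₀)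

    module _ {η} (0<η : 0# < η) (zN<η : z * (NA + L * N₀) < η) where

      -- After multiplication by `E₀` the claim is `EA - L E₀ < η E₀`. The leading terms `a ΘA` and
      -- `L a Θ₀` cancel, which leaves at most `z a (NA + L N₀) < η a ≤ η E₀`.
      ratio-L<η : EA / E₀ - L < η
      ratio-L<η = <-by (0<-cancelˡ 0<E₀ (<-resp-≈′ refl
        (solve 11 (λ a z e f t s n m l η r →
           a :* (η :- z :* (n :+ l :* m)) :+ (η :* (f :- a) :+ (a :* t :+ n :* (z :* a) :- e)
               :+ l :* (f :- (a :* s :- m :* (z :* a))) :+ (t :- l :* s) :* (:- a)
                 :+ (r :* f :- e) :* (:- con (+ 1)))
             := f :* (η :- (r :- l)))
           refl a z EA E₀ ΘA Θ₀ NA N₀ L η (EA / E₀))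
        (0<x+y (0<x*y 0<a (0<y-x zN<η))
          (<⇒≤ 0<η ⊗ 0≤y-x a≤E₀ ⊕ 0≤y-x EA≤ ⊕ 0≤L ⊗ 0≤y-x E₀≥
            ⊕ ≈⇒0≤[x-y]*m ΘA≈LΘ₀ (- a) ⊕ ≈⇒0≤[x-y]*m ratio*E₀≈EA (- 1#))))) refl

      -η<ratio-L : - η < EA / E₀ - L
      -η<ratio-L = <-by (0<-cancelˡ 0<E₀ (<-resp-≈′ refl
        (solve 11 (λ a z e f t s n m l η r →
           a :* (η :- z :* (n :+ l :* m)) :+ (η :* (f :- a) :+ (e :- (a :* t :- n :* (z :* a)))
               :+ l :* (a :* s :+ m :* (z :* a) :- f) :+ (t :- l :* s) :* a
                 :+ (r :* f :- e) :* con (+ 1))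
             := f :* (r :- l :- (:- η)))
           refl a z EA E₀ ΘA Θ₀ NA N₀ L η (EA / E₀))
        (0<x+y (0<x*y 0<a (0<y-x zN<η))
          (<⇒≤ 0<η ⊗ 0≤y-x a≤E₀ ⊕ 0≤y-x EA≥ ⊕ 0≤L ⊗ 0≤y-x E₀≤
            ⊕ ≈⇒0≤[x-y]*m ΘA≈LΘ₀ a ⊕ ≈⇒0≤[x-y]*m ratio*E₀≈EA 1#)))) refl

  -- The family and its limit ratio

  module Family (k : ℕ) (2≤k : 2 ℕ.≤ k) {ε} (0≤ε : 0# ≤ ε) (ε<1 : ε < 1#) where

    X : ℝ → ℝ → Points (k ℕ.* 2) (k ℕ.* 2)
    X = Instance.points k

    A : ℝ → ℝ → Sampler (k ℕ.* 2)
    A δ Δ = adversary k ε (X δ Δ)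

    κ H : ℝ
    κ = fromℕ k
    H = 𝓗 k

    0≤κ : 0# ≤ κ
    0≤κ = 0≤fromℕ k

    -- The constant `κ E` from the error terms of `expectation≤` and `expectation≥`.
    N : ℝ → ℝ
    N c = κ * (c * κ * (κ + κ + c * (κ * κ)))

    0≤N : ∀ {c} → 0# ≤ c → 0# ≤ N c
    0≤N 0≤c = 0≤κ ⊗ (0≤c ⊗ 0≤κ ⊗ (0≤κ ⊕ 0≤κ ⊕ 0≤c ⊗ (0≤κ ⊗ 0≤κ)))

    2≤κ : 1# + 1# ≤ κ
    2≤κ = ≤-resp-≈ (+-congˡ (+-identityʳ 1#)) refl (fromℕ-mono-≤ 2≤k)

    1≤H : 1# ≤ H
    1≤H = ≤-cancelˡ 0<2 (≤-by (0≤y-x (3≤2𝓗 2≤k) ⊕ 0≤1)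
      (solve 1 (λ h → con (+ 2) :* h :- con (+ 2) :* con (+ 1)
        := (con (+ 2) :* h :- (con (+ 1) :+ con (+ 1) :+ con (+ 1))) :+ con (+ 1)) refl H))

    0<H : 0# < H
    0<H = <-≤-trans 0<1 1≤H

    L : ℝ
    L = 1# + (H - 1#) / H * ε

    0≤L : 0# ≤ L
    0≤L = 0≤1 ⊕ 0≤y-x 1≤H ⊗ <⇒≤ (0<x⁻¹ 0<H) ⊗ 0≤ε

    Θ : ℝ → ℝ
    Θ c = κ + c * (κ * H - κ)

    -- `Θ 1` collapses to `κ H`, and the boost adds `ε κ (H - 1)`.
    Θ[1+ε]≈LΘ[1] : Θ (1# + ε) ≈ L * Θ 1#
    Θ[1+ε]≈LΘ[1] = ≈-by (≈⇒[x-y]*m≈0 (*-inverseʳ (>⇒≉0 0<H)) (- (κ * (H - 1#) * ε)))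
      (solve 4 (λ κ h i ε → κ :+ (con (+ 1) :+ ε) :* (κ :* h :- κ)
          :- (con (+ 1) :+ (h :- con (+ 1)) :* i :* ε) :* (κ :+ con (+ 1) :* (κ :* h :- κ))
          := (h :* i :- con (+ 1)) :* (:- (κ :* (h :- con (+ 1)) :* ε)))
        refl κ H (H ⁻¹) ε)

    2≤Θ[1] : 1# + 1# ≤ Θ 1#
    2≤Θ[1] = ≤-by (0≤y-x 2≤κ ⊕ 0≤κ ⊗ 0≤y-x 1≤H)
      (solve 2 (λ κ h → κ :+ con (+ 1) :* (κ :* h :- κ) :- con (+ 2)
        := (κ :- con (+ 2)) :+ κ :* (h :- con (+ 1))) refl κ H)

    ε/3≤ : ε / fromℕ 3 ≤ (H - 1#) / H * ε
    ε/3≤ = ≤-by (0≤ε ⊗ 0≤y-x (≤-cancelˡ (0<x*y 0<H (0<fromℕ[1+n] 2)) (≤-by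
        (0≤y-x (3≤2𝓗 2≤k) ⊕ ≈⇒0≤[x-y]*m (*-inverseʳ (>⇒≉0 0<H)) (fromℕ 3 * (H - 1#))
          ⊕ ≈⇒0≤[x-y]*m (*-inverseʳ (>⇒≉0 (0<fromℕ[1+n] 2))) (- H))
        (solve 3 (λ h i j → let three = con (+ 1) :+ (con (+ 1) :+ (con (+ 1) :+ con (+ 0))) in
          h :* three :* ((h :- con (+ 1)) :* i) :- h :* three :* j
            := (con (+ 2) :* h :- (con (+ 1) :+ con (+ 1) :+ con (+ 1)))
               :+ (h :* i :- con (+ 1)) :* (three :* (h :- con (+ 1)))
                 :+ (three :* j :- con (+ 1)) :* (:- h))
          refl H (H ⁻¹) (fromℕ 3 ⁻¹)))))
      (solve 3 (λ g j ε → g :* ε :- ε :* j := ε :* (g :- j)) refl ((H - 1#) / H) (fromℕ 3 ⁻¹) ε)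

    module At {δ Δ M} (0<δ : 0# < δ) (0<Δ : 0# < Δ) (1+κ≤M : 1# + κ ≤ M) (M≤Δ/δ : M ≤ Δ / δ) where
      1≤M : 1# ≤ M
      1≤M = O.trans (≤-by 0≤κ (solve 1 (λ κ → con (+ 1) :+ κ :- con (+ 1) := κ) refl κ)) 1+κ≤M

      κ≤M : κ ≤ M
      κ≤M = O.trans (≤-by 0≤1 (solve 1 (λ κ → con (+ 1) :+ κ :- κ := con (+ 1)) refl κ)) 1+κ≤M

      open Ratio 0<δ 0<Δ 1≤M M≤Δ/δ public using (z; 0<z; z*Δ²≈δ²; z*M≤1; z*N≤1; δ²*N≤Δ²)

      δ²≤Δ² : δ * δ ≤ Δ * Δ
      δ²≤Δ² = ≤-resp-≈ (*-identityʳ _) refl (δ²*N≤Δ² 1≤M)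

      same  = Instance.same-distance k δ Δ
      apart = Instance.apart-distance k δ Δ δ²≤Δ²

      separated : Clusters.Separated k (X δ Δ) (δ * δ) (Δ * Δ)
      separated = record { same-cluster = same ; apart = apart }

      equidistant : EquidistantClusters k 2 δ Δ (X δ Δ)
      equidistant = (λ i j i≢j ci≡cj → <⇒≤ 0<δ , sym (same i j i≢j ci≡cj)) ,
                    (λ i j ci≢cj → <⇒≤ 0<Δ , sym (apart i j ci≢cj))

      0<δ² : 0# < δ * δ
      0<δ² = 0<x*y 0<δ 0<δ

      0<Δ² : 0# < Δ * Δ
      0<Δ² = 0<x*y 0<Δ 0<Δ

      distinct : Distinct (X δ Δ)
      distinct {x} {y} Xx≈Xy = decidable-stable (x Fin.≟ y)
        λ x≢y → clash x≢y (quotient {k} 2 x Fin.≟ quotient {k} 2 y)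
        where
        ‖‖≈0 : ‖ X δ Δ x - X δ Δ y ‖² ≈ 0#
        ‖‖≈0 = trans (sum-cong-≋ λ i → ≈-by (≈⇒[x-y]*m≈0 (Xx≈Xy i) (X δ Δ x i - X δ Δ y i))
          (solve 2 (λ u v → (u :- v) :* (u :- v) :- con (+ 0) := (u :- v) :* (u :- v))
            refl (X δ Δ x i) (X δ Δ y i)))
          (sum-replicate-zero (k ℕ.* 2))
        clash : ¬ (x ≡ y) → ¬ Dec (quotient {k} 2 x ≡ quotient {k} 2 y)
        clash x≢y (yes c) = >⇒≉0 0<δ² (trans (sym (same x y x≢y c)) ‖‖≈0)
        clash x≢y (no ¬c) = >⇒≉0 0<Δ² (trans (sym (apart x y ¬c)) ‖‖≈0)

      open Samplers k 2≤k (X δ Δ) (δ * δ) (Δ * Δ) z (<⇒≤ 0<δ²) 0<Δ² δ²≤Δ² (<⇒≤ 0<z) z*Δ²≈δ² separated public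
        using (exact-boosts; exact-valid; module Adversary)
      open Adversary 0≤ε ε<1 (δ²*N≤Δ² κ≤M) public using (A-boosts; A-valid)
      open Recursion k (X δ Δ) (δ * δ) (Δ * Δ) z (<⇒≤ 0<δ²) 0<Δ² δ²≤Δ² (<⇒≤ 0<z) z*Δ²≈δ² separated
        using (expectation≤; expectation≥)

      0≤1+ε : 0# ≤ 1# + ε
      0≤1+ε = 0≤1 ⊕ 0≤ε

      module Close (N≤M : N 1#
        ≤ M) = Quotient {δ * δ} {z} {𝔼 k (X δ Δ) (A δ Δ)} {𝔼 k (X δ Δ) (exact (X δ Δ))}
        {Θ (1# + ε)} {Θ 1#} {N (1# + ε)} {N 1#} {L} 0<δ² 0≤L Θ[1+ε]≈LΘ[1] 2≤Θ[1] (z*N≤1 N≤M)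
        (≤-resp-≈ refl (+-congˡ (sym (*-assoc _ _ _))) (expectation≤ 0≤1+ε A-boosts 2≤k))
        (≤-resp-≈ (+-congˡ (-‿cong (sym (*-assoc _ _ _)))) refl (expectation≥ 0≤1+ε A-boosts 2≤k))
        (≤-resp-≈ refl (+-congˡ (sym (*-assoc _ _ _))) (expectation≤ 0≤1 exact-boosts 2≤k))
        (≤-resp-≈ (+-congˡ (-‿cong (sym (*-assoc _ _ _)))) refl (expectation≥ 0≤1 exact-boosts 2≤k))

    K : ℝ
    K = N (1# + ε) + L * N 1#

    0≤K : 0# ≤ K
    0≤K = 0≤N (0≤1 ⊕ 0≤ε) ⊕ 0≤L ⊗ 0≤N 0≤1

    -- One summand per demand: `1 + κ` yields `δ² ≤ Δ²` and `κ δ² ≤ Δ²`, `N 1` yields `z N 1 ≤ 1`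
    -- and with it a positive denominator, and the last summand yields `z K < η`.
    threshold : ℝ → ℝ
    threshold η = 1# + κ + N 1# + (1# + K) / η

    module _ {η} (0<η : 0# < η) where
      0≤[1+K]/η : 0# ≤ (1# + K) / η
      0≤[1+K]/η = (0≤1 ⊕ 0≤K) ⊗ <⇒≤ (0<x⁻¹ 0<η)

      1+κ≤threshold : 1# + κ ≤ threshold η
      1+κ≤threshold = ≤-by (0≤N 0≤1 ⊕ 0≤[1+K]/η)
        (solve 3 (λ κ n e → con (+ 1) :+ κ :+ n :+ e :- (con (+ 1) :+ κ) := n :+ e)
          refl κ (N 1#) ((1# + K) / η))

      N≤threshold : N 1# ≤ threshold η
      N≤threshold = ≤-by (0≤1 ⊕ 0≤κ ⊕ 0≤[1+K]/η)
        (solve 3 (λ κ n e → con (+ 1) :+ κ :+ n :+ e :- n := con (+ 1) :+ κ :+ e)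
          refl κ (N 1#) ((1# + K) / η))

      zK<η : ∀ {z} → 0# < z → z * threshold η ≤ 1# → z * K < η
      -- The 1 in `(1 + K) / η` leaves the slack `z`, which makes the inequality strict.
      zK<η {z} 0<z zM≤1 = <-by (0<x+y 0<z (<⇒≤ 0<η ⊗ 0≤y-x zM≤1
        ⊕ <⇒≤ 0<η ⊗ (<⇒≤ 0<z ⊗ (0≤1 ⊕ 0≤κ ⊕ 0≤N 0≤1))
          ⊕ ≈⇒0≤[x-y]*m (x/y*y≈x {1# + K} (>⇒≉0 0<η)) z))
        (solve 6 (λ κ n e η z K → η :- z :* K
            := z :+ (η :* (con (+ 1) :- z :* (con (+ 1) :+ κ :+ n :+ e)) :+ η :* (z :* (con (+ 1) :+ κ :+ n)) :+ (e :* η :- (con (+ 1) :+ K)) :* z))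
          refl κ (N 1#) ((1# + K) / η) η z K)

    limit : Limit (λ δ Δ → 𝔼 k (X δ Δ) (A δ Δ) / 𝔼 k (X δ Δ) (exact (X δ Δ))) L
    limit η 0<η = threshold η , λ δ Δ 0<δ 0<Δ M≤ →
      let module P = At 0<δ 0<Δ (1+κ≤threshold 0<η) M≤
          module C = P.Close (N≤threshold 0<η)
      in C.-η<ratio-L 0<η (zK<η 0<η P.0<z P.z*M≤1) , C.ratio-L<η 0<η (zK<η 0<η P.0<z P.z*M≤1)

    module Far {η} (0<η : 0# < η) where
      M : ℝ
      M = threshold η

      0<M : 0# < M
      0<M = <-≤-trans (0<x+y 0<1 0≤κ) (1+κ≤threshold 0<η)

      M≤M/1 : M ≤ M / 1#
      M≤M/1 = O.reflexive (trans (sym (*-identityʳ _))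
        (*-congˡ (trans (sym (*-inverseʳ (>⇒≉0 0<1))) (*-identityˡ _))))

      open At 0<1 0<M (1+κ≤threshold 0<η) M≤M/1 public
      open Close (N≤threshold 0<η) public using (0<E₀)

  -- A loss constant uniform in the number of clusters and the noise

  c : ℝ
  c = half * fromℕ 3 ⁻¹

  0<c : 0# < c
  0<c = 0<x*y 0<half (0<x⁻¹ (0<fromℕ[1+n] 2))

  -- The constant is `1/6`: the limit is at least `1 + ε/3`, and half of the gain is given up as the
  -- tolerance with which a single instance approaches it.
  unavoidable : ∀ (k : ℕ) → 2 ℕ.≤ k → ∀ (ε : ℝ) → 0# ≤ ε → ε < 1# →
          Σ[ d ∈ ℕ ] Σ[ n ∈ ℕ ] k ℕ.≤ n ×
          (Σ[ X ∈ Points d n ] Σ[ A ∈ Sampler n ]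
            Distinct X × Valid ε k X A ×
            0# < 𝔼 k X (exact X) ×
            1# + c * ε ≤ 𝔼 k X A / 𝔼 k X (exact X))
  unavoidable k 2≤k ε 0≤ε ε<1 with 0# O.≟ ε
  -- The tolerance `c * ε` would be zero here, so exact sampling itself is taken, with ratio 1.
  ... | yes 0≈ε = k ℕ.* 2 , k ℕ.* 2 , ℕ.m≤m*n k 2 , X 1# M , exact (X 1# M) ,
        distinct , exact-valid 0≤ε , 0<E₀ ,
        O.reflexive (trans (trans (+-congˡ
          (trans (*-congˡ (sym 0≈ε)) (zeroʳ c))) (+-identityʳ 1#)) (sym (*-inverseʳ (>⇒≉0 0<E₀))))
    where
    open Family k 2≤k 0≤ε ε<1
    open Far 0<1
  ... | no 0≉ε = k ℕ.* 2 , k ℕ.* 2 , ℕ.m≤m*n k 2 , X 1# M , A 1# M ,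
        distinct , A-valid , 0<E₀ ,
        ≤-by (0≤y-x ε/3≤ ⊕ <⇒≤ (0<y-x (proj₁ (proj₂ (limit (c * ε) 0<cε) 1# M 0<1 0<M M≤M/1)))
          ⊕ ≈⇒0≤[x-y]*m half+half≈1 (- (ε * fromℕ 3 ⁻¹)))
          (solve 5 (λ r g ε h j → r :- (con (+ 1) :+ h :* j :* ε)
              := (g :- ε :* j) :+ (r :- (con (+ 1) :+ g) :- (:- (h :* j :* ε)))
                :+ (h :+ h :- con (+ 1)) :* (:- (ε :* j)))
            refl (𝔼 k (X 1# M) (A 1# M) / 𝔼 k (X 1# M) (exact (X 1# M))) ((H - 1#) / H * ε) ε half (fromℕ 3 ⁻¹))
    where
    open Family k 2≤k 0≤ε ε<1
    0<cε : 0# < c * ε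
    0<cε = 0<x*y 0<c (0≤ε , 0≉ε)
    open Far 0<cε

  asymptotic : (∀ (k : ℕ) → 2 ℕ.≤ k → ∀ (ε : ℝ) → 0# ≤ ε → ε < 1# →
        Σ[ d ∈ ℕ ] Σ[ m ∈ ℕ ] 2 ℕ.≤ m ×
        (Σ[ X ∈ (ℝ → ℝ → Points d (k ℕ.* m)) ]
         Σ[ A ∈ (ℝ → ℝ → Sampler (k ℕ.* m)) ]
         Σ[ ρ ∈ ℝ ]
           (∀ δ Δ → 0# < δ → 0# < Δ → ρ ≤ Δ / δ →
              EquidistantClusters k m δ Δ (X δ Δ) × Valid ε k (X δ Δ) (A δ Δ)) ×
           (Σ[ L ∈ ℝ ]
              Limit (λ δ Δ → 𝔼 k (X δ Δ) (A δ Δ) / 𝔼 k (X δ Δ) (exact (X δ Δ))) L ×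
              1# + (𝓗 k - 1#) / 𝓗 k * ε ≤ L ×
              1# + ε / fromℕ 3 ≤ 1# + (𝓗 k - 1#) / 𝓗 k * ε)))
  -- From the ratio `1 + κ` on, `δ² ≤ Δ²` gives the geometry and `κ δ² ≤ Δ²` the validity of the
  -- adversary.
  asymptotic k 2≤k ε 0≤ε ε<1 = k ℕ.* 2 , 2 , ℕ.≤-refl , X , A , 1# + κ ,
    (λ δ Δ 0<δ 0<Δ ρ≤ → let module P = At 0<δ 0<Δ O.refl ρ≤ in P.equidistant , P.A-valid) ,
    L , limit , O.refl , +-monoʳ-≤ 1# ε/3≤
    where open Family k 2≤k 0≤ε ε<1

theorem5p1 : (ℜ : CompleteOrderedField) → let open KMeans ℜ in
  (∀ (k : ℕ) → 2 ℕ.≤ k → ∀ (ε : ℝ) → 0# ≤ ε → ε < 1# →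
    Σ[ d ∈ ℕ ] Σ[ m ∈ ℕ ] 2 ℕ.≤ m ×
    (Σ[ X ∈ (ℝ → ℝ → Points d (k ℕ.* m)) ]
     Σ[ A ∈ (ℝ → ℝ → Sampler (k ℕ.* m)) ]
     Σ[ ρ ∈ ℝ ]
       (∀ δ Δ → 0# < δ → 0# < Δ → ρ ≤ Δ / δ →
          EquidistantClusters k m δ Δ (X δ Δ) × Valid ε k (X δ Δ) (A δ Δ)) ×
       (Σ[ L ∈ ℝ ]
          Limit (λ δ Δ → 𝔼 k (X δ Δ) (A δ Δ) / 𝔼 k (X δ Δ) (exact (X δ Δ))) L ×
          1# + (𝓗 k - 1#) / 𝓗 k * ε ≤ L ×
          1# + ε / fromℕ 3 ≤ 1# + (𝓗 k - 1#) / 𝓗 k * ε))) ×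
  (Σ[ c ∈ ℝ ] 0# < c ×
    (∀ (k : ℕ) → 2 ℕ.≤ k → ∀ (ε : ℝ) → 0# ≤ ε → ε < 1# →
      Σ[ d ∈ ℕ ] Σ[ n ∈ ℕ ] k ℕ.≤ n ×
      (Σ[ X ∈ Points d n ] Σ[ A ∈ Sampler n ]
        Distinct X × Valid ε k X A ×
        0# < 𝔼 k X (exact X) ×
        1# + c * ε ≤ 𝔼 k X A / 𝔼 k X (exact X))))
theorem5p1 ℜ = asymptotic , c , 0<c , unavoidable
  where open Seeding ℜ
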